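{- Let $n\geq 2$ and let $BH_n$ be the $n$-dimensional balanced hypercube with bipartition $(V_0,V_1)$. Let $S=\{s_1,\dots,s_{2n-2}\}\subseteq V_0$ and $T=\{t_1,\dots,t_{2n-2}\}\subseteq V_1$ be sets of $2n-2$ distinct vertices each. Then there exist a permutation $\psi$ of $\{1,\dots,2n-2\}$ and pairwise vertex-disjoint paths $P_1,\dots,P_{2n-2}$ in $BH_n$ such that $P_i$ joins $s_i$ to $t_{\psi(i)}$ for each $i$ and $V(P_1)\cup\dots\cup V(P_{2n-2})=V(BH_n)$ (i.e., $BH_n$ has an unpaired $(2n-2)$-disjoint path cover joining $S$ and $T$).
   Context: The $n$-dimensional balanced hypercube $BH_n$ ($n\ge 1$) has vertex set $\{(a_0,a_1,\dots,a_{n-1}) : a_i\in\{0,1,2,3\}\}$ ($4^n$ vertices). A vertex $v=(a_0,\dots,a_{n-1})$ is adjacent to exactly the following $2n$ vertices: $((a_0\pm 1)\bmod 4, a_1,\dots,a_{n-1})$, and, for each $1\le i\le n-1$, $((a_0\pm1)\bmod 4, a_1,\dots,a_{i-1},(a_i+(-1)^{a_0})\bmod 4,a_{i+1},\dots,a_{n-1})$. $BH_n$ is bipartite with bipartition $V_0$ (vertices with even first coordinate $a_0$) and $V_1$ (vertices with odd first coordinate $a_0$). -}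

module Defs where

open import Data.Empty using (⊥)
open import Data.Fin.Base using (Fin; toℕ; fromℕ<)
open import Data.Integer.Base using (ℤ; +_; -1ℤ; _+_; _^_; _◃_)
open import Data.Integer.DivMod using (n%ℕd<d)
open import Data.List.Base using (List; head; last)
open import Data.List.Relation.Unary.Linked using (Linked)
open import Data.List.Relation.Unary.Unique.Propositional using (Unique)
open import Data.Maybe.Base using (just)
open import Data.Nat.Base using (ℕ)
open import Data.Nat.Divisibility using (_∣_; _∤_)
open import Data.Sign.Base using (Sign)
open import Data.Vec.Base using (Vec; []; _∷_; _[_]%=_)
open import Relation.Binary.Core using (Rel)
open import Relation.Binary.PropositionalEquality.Core using (_≡_)
open import Level using (0ℓ)

Vertex : ℕ → Set
Vertex n = Vec (Fin 4) n

-- (a + z) mod 4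
infixl 6 _⊕_
_⊕_ : Fin 4 → ℤ → Fin 4
a ⊕ z = fromℕ< (n%ℕd<d (+ toℕ a + z) 4)

-- Adjacency in BHₙ.  The head of the vector is a₀, and index i of the tail is
-- the coordinate aᵢ₊₁; σ ◃ 1 is the integer ±1.
infix 4 _∼_
data _∼_ : ∀ {n} → Rel (Vertex n) 0ℓ where
  inner : ∀ {m} (a : Fin 4) (as : Vec (Fin 4) m) (σ : Sign) →
          a ∷ as ∼ a ⊕ (σ ◃ 1) ∷ as
  outer : ∀ {m} (a : Fin 4) (as : Vec (Fin 4) m) (σ : Sign) (i : Fin m) →
          a ∷ as ∼ a ⊕ (σ ◃ 1) ∷ (as [ i ]%= (_⊕ (-1ℤ ^ toℕ a)))

-- BHₙ is only considered for n ≥ 1; the [] clauses are junk values.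
V₀ V₁ : ∀ {n} → Vertex n → Set
V₀ []      = ⊥
V₀ (a ∷ _) = 2 ∣ toℕ a
V₁ []      = ⊥
V₁ (a ∷ _) = 2 ∤ toℕ a

record Path {A : Set} (_R_ : Rel A 0ℓ) (u v : A) : Set where
  field
    vertices : List A
    starts   : head vertices ≡ just u
    ends     : last vertices ≡ just v
    linked   : Linked _R_ vertices
    simple   : Unique vertices

open Path public using (vertices)

{-# OPTIONS --safe #-}

-- The vertices (a, x) and (a + 2, x) are twins: they have the same neighbours.
-- Up to twins, x ∈ V₀ is adjacent to y ∈ V₁ iff y − x ∈ {0, e₁, …, eₘ} in ℤ₄ᵐ,
-- m = n − 1.  It suffices to find a permutation π of the vertices that moves every
-- v ∉ T along an edge, maps tᵢ to sᵢ, and has a single orbit: cutting the orbit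
-- at the arcs tᵢ → sᵢ gives the paths.
--
-- To find π, send V₀ to V₁ along a Hamiltonian cycle of the twin quotient (the
-- modular Gray code on ℤ₄ᵐ) and V₁ to V₀ by a perfect matching that is adjusted
-- to tᵢ ↦ sᵢ one index at a time.  Each adjustment is an alternating-path search;
-- it cannot get stuck, because X − {0, e₁, …, eₘ} is everything or has at least
-- |X| + m elements for every nonempty X ⊆ ℤ₄ᵐ, and at most 2m indices are forced.
-- Finally, whenever two twins lie in different orbits, exchanging their images
-- (in V₀) or their preimages (in V₁) keeps all arcs on edges and merges the two
-- orbits.  Once all twins share orbits, the Hamiltonian cycle makes the orbit
-- unique.
module Submission where

open import Defs
open import Data.Bool.Base using (Bool; true; false; T; _∨_)
open import Data.Bool.Properties using (T-∨)
open import Data.Fin.Base using (Fin; zero; suc; toℕ; fromℕ<)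
open import Data.Fin.Patterns using (0F; 1F; 2F; 3F)
open import Data.Fin.Permutation using (Permutation′; permutation; _⟨$⟩ʳ_)
open import Data.Fin.Properties using (_≟_; pigeonhole) renaming (all? to allᶠ?; any? to anyᶠ?)
open import Data.Integer.Base using (+_; -1ℤ; _^_; _◃_)
open import Data.List.Base using (List; []; _∷_; _++_; length; lookup; head; last; map; filter; allFin; cartesianProductWith)
open import Data.List.Membership.Propositional using (_∈_; _∉_; find; lose)
import Data.List.Membership.DecPropositional as DecMembership
open import Data.List.Membership.Propositional.Properties using (∈-∃++; ∈-++⁻; ∈-++⁺ˡ; ∈-++⁺ʳ; ∈-map⁺; ∈-map⁻; ∈-filter⁺; ∈-filter⁻; ∈-allFin; ∈-cartesianProductWith⁺)
open import Data.List.Properties using (length-++; length-map; length-tabulate; length-filter; filter-++; filter-notAll; filter-some)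
open import Data.List.Relation.Binary.Disjoint.Propositional using (Disjoint)
open import Data.List.Relation.Binary.Subset.Propositional using (_⊆_)
open import Data.List.Relation.Unary.All as All using (All; []; _∷_)
open import Data.List.Relation.Unary.All.Properties using (¬Any⇒All¬)
open import Data.List.Relation.Unary.AllPairs using ([]; _∷_)
open import Data.List.Relation.Unary.Any as Any using (Any; here; there; any?)
open import Data.List.Relation.Unary.Any.Properties using (lookup-index)
open import Data.List.Relation.Unary.Linked using (Linked; [-]; _∷_)
open import Data.List.Relation.Unary.Unique.Propositional using (Unique)
open import Data.List.Relation.Unary.Unique.Propositional.Properties using (filter⁺; allFin⁺; cartesianProductWith⁺) renaming (map⁺ to unique-map⁺; ++⁺ to unique-++⁺)
open import Data.Maybe.Base using (just)
open import Data.Nat.Base using (ℕ; zero; suc; _≤_; _<_; _+_; _*_; _∸_; _⊔_; z≤n; s≤s)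
open import Data.Nat.Divisibility using (divides; _∣?_)
open import Data.Nat.ListAction using (sum)
open import Data.Nat.Properties as ℕ using (≤-trans; ≤-reflexive; ≤-antisym; _≤?_; ≰⇒>; <⇒≢; n≢0⇒n>0; +-comm; +-suc; +-identityʳ; +-mono-≤; +-monoˡ-≤; +-monoʳ-≤; m≤m+n; m+1+n≰m; n≤1+n; 1+n≰n; m≤n⇒m≤1+n; m≤n⇒∃[o]m+o≡n; m≤m⊔n; m≤n⊔m; ⊔-identityʳ; *-suc; module ≤-Reasoning)
open import Data.Nat.Tactic.RingSolver using (solve-∀)
open import Data.Product.Base using (Σ-syntax; ∃-syntax; _×_; _,_; proj₁; proj₂)
open import Data.Sign.Base using (Sign; opposite)
open import Data.Sum.Base as Sum using (_⊎_; inj₁; inj₂)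
open import Data.Unit.Base using (tt)
open import Data.Vec.Base using (Vec; []; _∷_; _[_]%=_)
open import Data.Vec.Properties using (≡-dec; ∷-injective; ∷-injectiveʳ; updateAt-id-local; []%=-∘)
open import Function.Base using (_∘_; id; case_of_)
open import Function.Bundles using (_↔_; mk↔ₛ′; module Inverse; module Injection; module Equivalence)
open import Function.Construct.Composition using (_↔-∘_)
open import Function.Definitions using (Injective)
open import Function.Properties.Inverse using (↔⇒↣)
open import Level using (0ℓ)
open import Relation.Binary.Construct.Closure.ReflexiveTransitive using (Star; ε; _◅_; _◅◅_; gmap; concat)
open import Relation.Binary.Core using (Rel)
open import Relation.Binary.Definitions using (DecidableEquality)
open import Relation.Binary.PropositionalEquality using (_≡_; _≢_; refl; sym; trans; cong; cong₂; subst; subst₂; module ≡-Reasoning)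
open import Relation.Binary.Structures using (IsEquivalence)
open import Relation.Nullary.Decidable using (Dec; yes; no; from-no; isYes; does; toWitness; fromWitness; map′; decidable-stable; T?; ¬?; _×-dec_; _⊎-dec_; _→-dec_)
open import Relation.Nullary.Negation using (¬_; contradiction)
open import Relation.Unary using (Pred; Decidable)

open Inverse using (to; from; strictlyInverseˡ; strictlyInverseʳ)

-- Lengths of lists without repetitions.

unique-⊆⇒length≤ : ∀ {A : Set} {xs ys : List A} → Unique xs → xs ⊆ ys → length xs ≤ length ys
unique-⊆⇒length≤ [] _ = z≤n
unique-⊆⇒length≤ {xs = x ∷ xs} (x∉xs ∷ xs!) xs⊆ys with ∈-∃++ (xs⊆ys (here refl))
... | l , r , refl = begin
  suc (length xs)           ≤⟨ s≤s (unique-⊆⇒length≤ xs! xs⊆l++r) ⟩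
  suc (length (l ++ r))     ≡⟨ cong suc (length-++ l) ⟩
  suc (length l + length r) ≡⟨ +-suc (length l) (length r) ⟨
  length l + suc (length r) ≡⟨ length-++ l ⟨
  length (l ++ x ∷ r)       ∎
  where
  open ≤-Reasoning
  xs⊆l++r : xs ⊆ l ++ r
  xs⊆l++r z∈xs with ∈-++⁻ l (xs⊆ys (there z∈xs))
  ... | inj₁ z∈l          = ∈-++⁺ˡ z∈l
  ... | inj₂ (here refl)  = contradiction refl (All.lookup x∉xs z∈xs)
  ... | inj₂ (there z∈r)  = ∈-++⁺ʳ l z∈r

-- Permutations of a finite set

module FinitePermutation {V : Set} (_≟_ : DecidableEquality V)
                         (univ : List V) (complete : ∀ v → v ∈ univ) where

  open DecMembership _≟_ using (_∈?_)

  to-injective : (π : V ↔ V) → ∀ {u v} → to π u ≡ to π v → u ≡ v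
  to-injective π = Injection.injective (↔⇒↣ π)

  exchange : V → V → V → V
  exchange a b v with v ≟ a | v ≟ b
  ... | yes _ | _     = b
  ... | no _  | yes _ = a
  ... | no _  | no _  = v

  exchange-left : ∀ a b → exchange a b a ≡ b
  exchange-left a b with a ≟ a | a ≟ b
  ... | yes _  | _ = refl
  ... | no a≢a | _ = contradiction refl a≢a

  exchange-right : ∀ a b → exchange a b b ≡ a
  exchange-right a b with b ≟ a | b ≟ b
  ... | yes b≡a | _      = b≡a
  ... | no _    | yes _  = refl
  ... | no _    | no b≢b = contradiction refl b≢b

  exchange-other : ∀ {a b v} → v ≢ a → v ≢ b → exchange a b v ≡ v
  exchange-other {a} {b} {v} v≢a v≢b with v ≟ a | v ≟ b
  ... | yes v≡a | _       = contradiction v≡a v≢a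
  ... | no _    | yes v≡b = contradiction v≡b v≢b
  ... | no _    | no _    = refl

  -- Relating a vertex to its exchanged copy reduces every later claim about a permutation after an
  -- exchange to three goals.
  exchange-elim : ∀ (P : V → V → Set) {a b} → P a b → P b a →
                  (∀ {v} → v ≢ a → v ≢ b → P v v) → ∀ v → P v (exchange a b v)
  exchange-elim P {a} {b} pab pba p v with v ≟ a | v ≟ b
  ... | yes refl | _        = pab
  ... | no _     | yes refl = pba
  ... | no v≢a   | no v≢b   = p v≢a v≢b

  exchange-involutive : ∀ a b v → exchange a b (exchange a b v) ≡ v
  exchange-involutive a b = exchange-elim (λ v w → exchange a b w ≡ v)
    (exchange-right a b) (exchange-left a b) exchange-other

  infixl 9 _∘⟨_↔_⟩
  _∘⟨_↔_⟩ : V ↔ V → V → V → V ↔ V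
  π ∘⟨ a ↔ b ⟩ = π ↔-∘ mk↔ₛ′ (exchange a b) (exchange a b)
                             (exchange-involutive a b) (exchange-involutive a b)

  exchange-pointwise : ∀ (R : Rel V 0ℓ) (π : V ↔ V) {a b} → R a (to π b) → R b (to π a) →
                       (∀ v → v ≢ a → v ≢ b → R v (to π v)) →
                       ∀ v → R v (to (π ∘⟨ a ↔ b ⟩) v)
  exchange-pointwise R π Rab Rba R′ =
    exchange-elim (λ v w → R v (to π w)) Rab Rba (λ v≢a v≢b → R′ _ v≢a v≢b)

  -- Repairing one failing arc by alternating paths.

  module Repair (R : Rel V 0ℓ) (R? : ∀ u v → Dec (R u v)) (π : V ↔ V) (bad : V)
                (good : ∀ v → v ≢ bad → R v (to π v)) where

    -- The failure at bad has been moved to k by rotating images inside X.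
    Moved : List V → V → Set
    Moved X k = Σ[ ρ ∈ V ↔ V ] (∀ v → v ≢ k → R v (to ρ v)) ×
                               to ρ k ≡ to π bad ×
                               (∀ v → v ∉ X → to ρ v ≡ to π v)

    -- Every vertex has the form `to π v`, so closedness puts all `R`-neighbours of `X` into the
    -- image of `X` without `bad`. If `bad ∈ X`, this is a violation of Hall's condition.
    Closed : List V → Set
    Closed X = ∀ {u v} → u ∈ X → R u (to π v) → v ∈ X × v ≢ bad

    Outcome : Set
    Outcome = (Σ[ ρ ∈ V ↔ V ] (∀ v → R v (to ρ v))) ⊎ (Σ[ X ∈ List V ] bad ∈ X × Closed X)

    -- One alternating step: `u` takes over the image of `k`, and `k` inherits the image of `bad`.
    -- As `k` lies outside `X`, its image has not been touched by earlier steps, so `Ruk` still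
    -- applies.
    move : ∀ {X u k} → u ∈ X → k ∉ X → R u (to π k) → Moved X u → Moved (k ∷ X) k
    move {X} {u} {k} u∈X k∉X Ruk (ρ , ok , ρu≡ , same) = ρ ∘⟨ u ↔ k ⟩ , ok′ ,
      trans (cong (to ρ) (exchange-right u k)) ρu≡ , same′
      where
      ok′ : ∀ v → v ≢ k → R v (to (ρ ∘⟨ u ↔ k ⟩) v)
      ok′ = exchange-elim (λ v w → v ≢ k → R v (to ρ w))
        (λ _ → subst (R u) (sym (same k k∉X)) Ruk)
        (λ k≢k → contradiction refl k≢k)
        (λ v≢u _ _ → ok _ v≢u)
      same′ : ∀ v → v ∉ k ∷ X → to (ρ ∘⟨ u ↔ k ⟩) v ≡ to π v
      same′ v v∉ = trans (cong (to ρ) (exchange-other (λ { refl → v∉ (there u∈X) }) (v∉ ∘ here)))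
                         (same v (v∉ ∘ there))

    weaken : ∀ {X u k} → Moved X u → Moved (k ∷ X) u
    weaken (ρ , ok , eq , same) = ρ , ok , eq , λ v v∉ → same v (v∉ ∘ there)

    -- The failure can be moved to any vertex of `X`, so the search succeeds once some `u` in `X` is
    -- related to `to π bad`. If that never happens and no new vertex can be added, `X` is closed.
    grow : ∀ fuel X → length univ ≤ length X + fuel → Unique X → bad ∈ X →
           (∀ {u} → u ∈ X → Moved X u) → Outcome
    grow fuel X enough X! bad∈X moved
      with any? (λ u → R? u (to π bad)) X
    ... | yes finish with find finish
    ...   | u , u∈X , Ru with moved u∈X
    ...     | ρ , ok , ρu≡ , _ = inj₁ (ρ , λ v → case v ≟ u of λ where
                (yes refl) → subst (R u) (sym ρu≡) Ru
                (no v≢u)   → ok v v≢u)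
    grow fuel X enough X! bad∈X moved | no ¬finish
      with any? (λ v → ¬? (v ∈? X) ×-dec any? (λ u → R? u (to π v)) X) univ
    ... | no ¬extend = inj₂ (X , bad∈X , closed)
      where
      closed : Closed X
      closed {u} {v} u∈X Ruv with v ∈? X
      ... | no v∉X  = contradiction (lose (complete v) (v∉X , lose u∈X Ruv)) ¬extend
      ... | yes v∈X = v∈X , λ { refl → ¬finish (lose u∈X Ruv) }
    ... | yes extend with find extend
    ...   | k , _ , k∉X , from-X with find from-X
    ...     | u , u∈X , Ruk = continue fuel enough
      where
      k∷X! : Unique (k ∷ X)
      k∷X! = ¬Any⇒All¬ X k∉X ∷ X!
      moved′ : ∀ {w} → w ∈ k ∷ X → Moved (k ∷ X) w
      moved′ (here refl)  = move u∈X k∉X Ruk (moved u∈X)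
      moved′ (there w∈X) = weaken (moved w∈X)
      continue : ∀ fuel → length univ ≤ length X + fuel → Outcome
      -- Without fuel `X` is already as long as `univ`, so there is no room for the new vertex `k`.
      continue zero        le = contradiction
        (≤-trans (unique-⊆⇒length≤ k∷X! (λ {v} _ → complete v))
                 (≤-trans le (≤-reflexive (+-identityʳ _)))) 1+n≰n
      continue (suc fuel′) le = grow fuel′ (k ∷ X)
        (≤-trans le (≤-reflexive (+-suc (length X) fuel′))) k∷X! (there bad∈X) moved′

    outcome : Outcome
    outcome = grow (length univ) (bad ∷ []) (n≤1+n _) ([] ∷ []) (here refl)
      λ { (here refl) → π , good , refl , λ _ _ → refl }

  -- Orbits of a permutation.

  infix 4 _⟶[_]_
  _⟶[_]_ : V → V ↔ V → V → Set
  u ⟶[ π ] v = Star (λ x y → to π x ≡ y) u v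

  iterate : (V → V) → ℕ → V → V
  iterate f zero    v = v
  iterate f (suc k) v = iterate f k (f v)

  iterate-+ : ∀ f j k v → iterate f (j + k) v ≡ iterate f k (iterate f j v)
  iterate-+ f zero    k v = refl
  iterate-+ f (suc j) k v = iterate-+ f j k (f v)

  module _ (π : V ↔ V) where

    iterate-injective : ∀ k {u v} → iterate (to π) k u ≡ iterate (to π) k v → u ≡ v
    iterate-injective zero    eq = eq
    iterate-injective (suc k) eq = to-injective π (iterate-injective k eq)

    iterate-⟶ : ∀ k v → v ⟶[ π ] iterate (to π) k v
    iterate-⟶ zero    v = ε
    iterate-⟶ (suc k) v = refl ◅ iterate-⟶ k (to π v)

    -- Pigeonhole on the positions of the iterates in `univ` gives two equal iterates; injectivity
    -- cancels their `toℕ i` common steps.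
    periodic : ∀ v → ∃[ k ] iterate (to π) (suc k) v ≡ v
    periodic v
      with pigeonhole {n = suc (length univ)} (≤-reflexive refl)
                      (λ i → Any.index (complete (iterate (to π) (toℕ i) v)))
    ... | i , j , i<j , same-index with m≤n⇒∃[o]m+o≡n i<j
    ...   | k , 1+i+k≡j = k , iterate-injective (toℕ i) (begin
      iterate f (toℕ i) (iterate f (suc k) v) ≡⟨ iterate-+ f (suc k) (toℕ i) v ⟨
      iterate f (suc k + toℕ i) v             ≡⟨ cong (λ e → iterate f e v) (trans (cong suc (+-comm k (toℕ i))) 1+i+k≡j) ⟩
      iterate f (toℕ j) v                     ≡⟨ lookup-index (complete (iterate f (toℕ j) v)) ⟩
      lookup univ (Any.index (complete (iterate f (toℕ j) v))) ≡⟨ cong (lookup univ) same-index ⟨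
      lookup univ (Any.index (complete (iterate f (toℕ i) v))) ≡⟨ lookup-index (complete (iterate f (toℕ i) v)) ⟨
      iterate f (toℕ i) v                     ∎)
      where
      open ≡-Reasoning
      f = to π

    -- This makes forward reachability symmetric: an arc is undone by running through the rest of
    -- its cycle.
    return : ∀ v → to π v ⟶[ π ] v
    return v with periodic v
    ... | k , eq = subst (to π v ⟶[ π ]_) eq (iterate-⟶ k (to π v))

    ⟶-sym : ∀ {u v} → u ⟶[ π ] v → v ⟶[ π ] u
    ⟶-sym ε             = ε
    ⟶-sym (refl ◅ path) = ⟶-sym path ◅◅ return _

    infix 4 _⊑_
    _⊑_ : V ↔ V → Set
    _⊑_ ρ = ∀ {u v} → u ⟶[ π ] v → u ⟶[ ρ ] v

  -- Merging two orbits by exchanging two images.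

  module Merge (π : V ↔ V) (a b : V) where

    merged : V ↔ V
    merged = π ∘⟨ a ↔ b ⟩

    -- Both permutations agree away from `a` and `b`, so the path up to the first visit to either of
    -- them is common to both.
    first-hit : ∀ {u v} → v ≡ a ⊎ v ≡ b → u ⟶[ π ] v →
                (u ⟶[ π ] a × u ⟶[ merged ] a) ⊎ (u ⟶[ π ] b × u ⟶[ merged ] b)
    first-hit (inj₁ refl) ε = inj₁ (ε , ε)
    first-hit (inj₂ refl) ε = inj₂ (ε , ε)
    first-hit {u} end (refl ◅ path) with u ≟ a | u ≟ b
    ... | yes refl | _        = inj₁ (ε , ε)
    ... | no _     | yes refl = inj₂ (ε , ε)
    ... | no u≢a   | no u≢b   = Sum.map extend extend (first-hit end path)
      where
      extend : ∀ {w} → to π u ⟶[ π ] w × to π u ⟶[ merged ] w → u ⟶[ π ] w × u ⟶[ merged ] w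
      extend (p , q) = refl ◅ p , cong (to π) (exchange-other u≢a u≢b) ◅ q

    -- If the path from `to π a` meets `b` first, or that from `to π b` meets `a` first, the orbits
    -- coincide. Otherwise both paths survive the exchange, and the two new arcs splice them into
    -- one cycle through `a` and `b`. Every old arc can then be replaced by a path of `merged`.
    same-orbit-or-merges : a ⟶[ π ] b ⊎ (a ⟶[ merged ] b × π ⊑ merged)
    same-orbit-or-merges
      with first-hit (inj₁ refl) (return π a) | first-hit (inj₂ refl) (return π b)
    ... | inj₂ (a⟶b , _) | _              = inj₁ (refl ◅ a⟶b)
    ... | inj₁ _         | inj₁ (b⟶a , _) = inj₁ (⟶-sym π (refl ◅ b⟶a))
    ... | inj₁ (_ , πa⟶a) | inj₂ (_ , πb⟶b) = inj₂ (a⟶b , concat ∘ gmap id step)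
      where
      a⟶πb : a ⟶[ merged ] to π b
      a⟶πb = cong (to π) (exchange-left a b) ◅ ε
      b⟶πa : b ⟶[ merged ] to π a
      b⟶πa = cong (to π) (exchange-right a b) ◅ ε
      a⟶b : a ⟶[ merged ] b
      a⟶b = a⟶πb ◅◅ πb⟶b
      b⟶a : b ⟶[ merged ] a
      b⟶a = b⟶πa ◅◅ πa⟶a
      step : ∀ {u v} → to π u ≡ v → u ⟶[ merged ] v
      step {u} refl with u ≟ a | u ≟ b
      ... | yes refl | _        = a⟶b ◅◅ b⟶πa
      ... | no _     | yes refl = b⟶a ◅◅ a⟶πb
      ... | no u≢a   | no u≢b   = cong (to π) (exchange-other u≢a u≢b) ◅ ε

  abstract
    merge : ∀ (R : Rel V 0ℓ) (π : V ↔ V) a b → (∀ v → R v (to π v)) →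
            R a (to π b) → R b (to π a) →
            Σ[ ρ ∈ V ↔ V ] (∀ v → R v (to ρ v)) × π ⊑ ρ × a ⟶[ ρ ] b
    merge R π a b ok Rab Rba with Merge.same-orbit-or-merges π a b
    ... | inj₁ a⟶b       = π , ok , id , a⟶b
    ... | inj₂ (a⟶b , π⊑) =
      Merge.merged π a b , exchange-pointwise R π Rab Rba (λ v _ _ → ok v) , π⊑ , a⟶b

  -- Cutting a single orbit into disjoint paths.

  module CutCycle (_R_ : Rel V 0ℓ) {k : ℕ} (s t : Fin k → V)
                  (s-injective : Injective _≡_ _≡_ s) (t-injective : Injective _≡_ _≡_ t)
                  (π : V ↔ V) (π-t : ∀ i → to π (t i) ≡ s i)
                  (π-step : ∀ {v} → (∀ i → v ≢ t i) → v R to π v)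
                  (i₀ : Fin k) (transitive : ∀ u v → u ⟶[ π ] v) where

    -- The orbit from `v` up to its first terminal `t i`, as an inductive type so that termination
    -- is part of the data.
    data Walk (v : V) : Set where
      stop : ∀ i → v ≡ t i → Walk v
      go   : (∀ i → v ≢ t i) → Walk (to π v) → Walk v

    infix 4 _⇒_
    infixl 5 _▷_
    infixr 5 _◁_
    -- Grown at the far end, so that two such paths can be traced backwards in step in
    -- `unique-source`.
    data _⇒_ (u : V) : V → Set where
      []  : u ⇒ u
      _▷_ : ∀ {v} → u ⇒ v → (∀ i → v ≢ t i) → u ⇒ to π v

    _◁_ : ∀ {u v} → (∀ i → u ≢ t i) → to π u ⇒ v → u ⇒ v
    u∉t ◁ []        = [] ▷ u∉t
    u∉t ◁ (p ▷ v∉t) = (u∉t ◁ p) ▷ v∉t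

    t? : ∀ v → (∃[ i ] v ≡ t i) ⊎ (∀ i → v ≢ t i)
    t? v with anyᶠ? (λ i → v ≟ t i)
    ... | yes p = inj₁ p
    ... | no ¬p = inj₂ λ i eq → ¬p (i , eq)

    walk-along : ∀ {v} → v ⟶[ π ] t i₀ → Walk v
    walk-along ε = stop i₀ refl
    walk-along {v} (refl ◅ path) with t? v
    ... | inj₁ (i , v≡t) = stop i v≡t
    ... | inj₂ v∉t       = go v∉t (walk-along path)

    walk : ∀ v → Walk v
    walk v = walk-along (transitive v (t i₀))

    trace : ∀ {v} → Walk v → List V
    trace {v} (stop _ _) = v ∷ []
    trace {v} (go _ w)   = v ∷ trace w

    end : ∀ {v} → Walk v → Fin k
    end (stop i _) = i
    end (go _ w)   = end w

    head-trace : ∀ {v} (w : Walk v) → head (trace w) ≡ just v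
    head-trace (stop _ _) = refl
    head-trace (go _ w)   = refl

    last-trace : ∀ {v} (w : Walk v) → last (trace w) ≡ just (t (end w))
    last-trace (stop _ v≡t)      = cong just v≡t
    last-trace (go _ (stop _ v≡t)) = cong just v≡t
    last-trace (go _ w@(go _ _)) = last-trace w

    linked-trace : ∀ {v} (w : Walk v) → Linked _R_ (trace w)
    linked-trace (stop _ _)            = [-]
    linked-trace (go v∉t (stop _ _))   = π-step v∉t ∷ [-]
    linked-trace (go v∉t w@(go _ _))   = π-step v∉t ∷ linked-trace w

    start∈trace : ∀ {v} (w : Walk v) → v ∈ trace w
    start∈trace (stop _ _) = here refl
    start∈trace (go _ _)   = here refl

    end∈trace : ∀ {v} (w : Walk v) → t (end w) ∈ trace w
    end∈trace (stop _ v≡t) = here (sym v≡t)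
    end∈trace (go _ w)     = there (end∈trace w)

    t∈trace⇒end : ∀ {v j} (w : Walk v) → t j ∈ trace w → end w ≡ j
    t∈trace⇒end (stop _ v≡t) (here t≡v)  = sym (t-injective (trans t≡v v≡t))
    t∈trace⇒end (go v∉t w)   (here t≡v)  = contradiction (sym t≡v) (v∉t _)
    t∈trace⇒end (go v∉t w)   (there t∈w) = t∈trace⇒end w t∈w

    size : ∀ {v} → Walk v → ℕ
    size (stop _ _) = zero
    size (go _ w)   = suc (size w)

    -- A walk is determined by its start, so sizes cannot increase along a trace. A vertex recurring
    -- in its own tail would have a walk no longer than that tail, which gives `unique-trace`.
    trace-size≤ : ∀ {u v} (w : Walk u) (w′ : Walk v) → v ∈ trace w → size w′ ≤ size w
    trace-size≤ w              (stop _ _)    _           = z≤n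
    trace-size≤ (stop _ u≡t)   (go v∉t _)    (here refl) = contradiction u≡t (v∉t _)
    trace-size≤ (go _ w)       (go _ w′)     (here refl) = s≤s (trace-size≤ w w′ (start∈trace w))
    trace-size≤ (go _ w)       w′@(go _ _)   (there v∈w) = m≤n⇒m≤1+n (trace-size≤ w w′ v∈w)

    unique-trace : ∀ {v} (w : Walk v) → Unique (trace w)
    unique-trace (stop _ _)     = [] ∷ []
    unique-trace w@(go v∉t w′) =
      ¬Any⇒All¬ _ (λ v∈w′ → 1+n≰n (trace-size≤ w′ w v∈w′)) ∷ unique-trace w′

    ∈trace⇒reached : ∀ {u v} (w : Walk u) → v ∈ trace w → u ⇒ v
    ∈trace⇒reached (stop _ _) (here refl) = []
    ∈trace⇒reached (go _ _)   (here refl) = []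
    ∈trace⇒reached (go u∉t w) (there v∈w) = u∉t ◁ ∈trace⇒reached w v∈w

    next∈trace : ∀ {u v} (w : Walk u) → v ∈ trace w → (∀ i → v ≢ t i) → to π v ∈ trace w
    next∈trace (stop _ u≡t) (here refl) v∉t = contradiction u≡t (v∉t _)
    next∈trace (go _ w)     (here refl) _   = there (start∈trace w)
    next∈trace (go _ w)     (there v∈w) v∉t = there (next∈trace w v∈w v∉t)

    reached⇒∈trace : ∀ {u v} (w : Walk u) → u ⇒ v → v ∈ trace w
    reached⇒∈trace w []        = start∈trace w
    reached⇒∈trace w (p ▷ v∉t) = next∈trace w (reached⇒∈trace w p) v∉t

    π≡s⇒t : ∀ {v i} → to π v ≡ s i → v ≡ t i
    π≡s⇒t {i = i} eq = to-injective π (trans eq (sym (π-t i)))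

    -- Going backwards, injectivity of `π` keeps the two paths together. They reach their sources
    -- simultaneously, since the only predecessor of `s i` is `t i`, which no path passes.
    unique-source : ∀ {i j u v} → s i ⇒ u → s j ⇒ v → u ≡ v → i ≡ j
    unique-source []        []        eq = s-injective eq
    unique-source []        (_ ▷ v∉t) eq = contradiction (π≡s⇒t (sym eq)) (v∉t _)
    unique-source (_ ▷ u∉t) []        eq = contradiction (π≡s⇒t eq) (u∉t _)
    unique-source (p ▷ _)   (q ▷ _)   eq = unique-source p q (to-injective π eq)

    -- Follow the orbit and remember the current source; on leaving a terminal `t j` the next vertex
    -- is `s j`, which becomes the new source.
    source-along : ∀ {u v} → ∃[ i ] s i ⇒ u → u ⟶[ π ] v → ∃[ i ] s i ⇒ v
    source-along p ε = p
    source-along {u} (i , p) (refl ◅ path) with t? u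
    ... | inj₁ (j , refl) = source-along (j , subst (s j ⇒_) (sym (π-t j)) []) path
    ... | inj₂ u∉t        = source-along (i , p ▷ u∉t) path

    source : ∀ v → ∃[ i ] s i ⇒ v
    source v = source-along (i₀ , []) (transitive (s i₀) v)

    ψ : Permutation′ k
    ψ = permutation (λ i → end (walk (s i))) (λ j → proj₁ (source (t j)))
      (λ j → t∈trace⇒end _ (reached⇒∈trace (walk (s (proj₁ (source (t j))))) (proj₂ (source (t j)))))
      (λ i → unique-source (proj₂ (source _)) (∈trace⇒reached _ (end∈trace (walk (s i)))) refl)

    path : ∀ i → Path _R_ (s i) (t (ψ ⟨$⟩ʳ i))
    path i = record
      { vertices = trace w
      ; starts   = head-trace w
      ; ends     = last-trace w
      ; linked   = linked-trace w
      ; simple   = unique-trace w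
      }
      where w = walk (s i)

    paths-disjoint : ∀ i j → i ≢ j → Disjoint (vertices (path i)) (vertices (path j))
    paths-disjoint i j i≢j (v∈i , v∈j) =
      i≢j (unique-source (∈trace⇒reached _ v∈i) (∈trace⇒reached _ v∈j) refl)

    paths-cover : ∀ v → ∃[ i ] v ∈ vertices (path i)
    paths-cover v with source v
    ... | i , p = i , reached⇒∈trace (walk (s i)) p

-- Expansion in ℤ₄ᵐ

inc dec : Fin 4 → Fin 4
inc = _⊕ + 1
dec = _⊕ -1ℤ

dec-inc : ∀ a → dec (inc a) ≡ a
dec-inc = toWitness {a? = allᶠ? λ a → dec (inc a) ≟ a} tt

inc-dec : ∀ a → inc (dec a) ≡ a
inc-dec = toWitness {a? = allᶠ? λ a → inc (dec a) ≟ a} tt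

Cube : ℕ → Set
Cube m = Vec (Fin 4) m

allCube : ∀ m → List (Cube m)
allCube zero    = [] ∷ []
allCube (suc m) = cartesianProductWith _∷_ (allFin 4) (allCube m)

∈-allCube : ∀ {m} (v : Cube m) → v ∈ allCube m
∈-allCube []      = here refl
∈-allCube (a ∷ v) = ∈-cartesianProductWith⁺ _∷_ (∈-allFin a) (∈-allCube v)

allCube-unique : ∀ m → Unique (allCube m)
allCube-unique zero    = [] ∷ []
allCube-unique (suc m) = cartesianProductWith⁺ _∷_ ∷-injective (allFin⁺ 4) (allCube-unique m)

elements : ∀ {m} → (Cube m → Bool) → List (Cube m)
elements {m} X = filter (T? ∘ X) (allCube m)

∈-elements : ∀ {m} (X : Cube m → Bool) {v} → T (X v) → v ∈ elements X
∈-elements X = ∈-filter⁺ (T? ∘ X) (∈-allCube _)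

elements-sound : ∀ {m} (X : Cube m → Bool) {v} → v ∈ elements X → T (X v)
elements-sound {m} X v∈X = proj₂ (∈-filter⁻ (T? ∘ X) {xs = allCube m} v∈X)

elements-unique : ∀ {m} (X : Cube m → Bool) → Unique (elements X)
elements-unique X = filter⁺ (T? ∘ X) (allCube-unique _)

card : ∀ {m} → (Cube m → Bool) → ℕ
card X = length (elements X)

order : ℕ → ℕ
order m = length (allCube m)

card≤order : ∀ {m} (X : Cube m → Bool) → card X ≤ order m
card≤order {m} X = length-filter (T? ∘ X) (allCube m)

card-mono : ∀ {m} (X Y : Cube m → Bool) → (∀ v → T (X v) → T (Y v)) → card X ≤ card Y
card-mono {m} X Y X⊆Y = unique-⊆⇒length≤ (elements-unique X) λ v∈X →
  ∈-elements Y (X⊆Y _ (elements-sound X v∈X))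

card-full : ∀ {m} (X : Cube m → Bool) → card X ≡ order m → ∀ v → T (X v)
card-full X full v = decidable-stable (T? (X v)) λ ¬Xv →
  <⇒≢ (filter-notAll (T? ∘ X) _ (lose (∈-allCube v) ¬Xv)) full

card-nonempty : ∀ {m} (X : Cube m → Bool) {v} → T (X v) → 0 < card X
card-nonempty X {v} Xv = filter-some (T? ∘ X) (lose (∈-allCube v) Xv)

length-filter-map : ∀ {A B : Set} {P : Pred B 0ℓ} (P? : Decidable P) (f : A → B) xs →
                    length (filter P? (map f xs)) ≡ length (filter (P? ∘ f) xs)
length-filter-map P? f []       = refl
length-filter-map P? f (x ∷ xs) with does (P? (f x))
... | true  = cong suc (length-filter-map P? f xs)
... | false = length-filter-map P? f xs

slice : ∀ {m} → (Cube (suc m) → Bool) → Fin 4 → Cube m → Bool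
slice X a v = X (a ∷ v)

card-slices : ∀ {m} (X : Cube (suc m) → Bool) → card X ≡ sum (map (card ∘ slice X) (allFin 4))
card-slices {m} X = go (allFin 4)
  where
  open ≡-Reasoning
  go : ∀ as → length (filter (T? ∘ X) (cartesianProductWith _∷_ as (allCube m)))
              ≡ sum (map (card ∘ slice X) as)
  go []       = refl
  go (a ∷ as) = begin
    length (filter (T? ∘ X) (first ++ rest))                       ≡⟨ cong length (filter-++ (T? ∘ X) first rest) ⟩
    length (filter (T? ∘ X) first ++ filter (T? ∘ X) rest)         ≡⟨ length-++ (filter (T? ∘ X) first) ⟩
    length (filter (T? ∘ X) first) + length (filter (T? ∘ X) rest) ≡⟨ cong₂ _+_ (length-filter-map (T? ∘ X) (a ∷_) (allCube m)) (go as) ⟩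
    card (slice X a) + sum (map (card ∘ slice X) as)               ∎
    where
    first = map (a ∷_) (allCube m)
    rest  = cartesianProductWith _∷_ as (allCube m)

order-suc : ∀ m → order (suc m) ≡ order m + (order m + (order m + (order m + 0)))
order-suc m = go (allFin 4)
  where
  go : ∀ as → length (cartesianProductWith {C = Cube (suc m)} _∷_ as (allCube m)) ≡ sum (map (λ _ → order m) as)
  go []       = refl
  go (a ∷ as) = trans (length-++ (map (a ∷_) (allCube m)))
                      (cong₂ _+_ (length-map (a ∷_) (allCube m)) (go as))

m<order : ∀ m → m < order m
m<order zero    = s≤s z≤n
m<order (suc m) = begin
  suc (suc m)                        ≤⟨ s≤s (m<order m) ⟩
  1 + order m                        ≤⟨ +-monoˡ-≤ (order m) (≤-trans (s≤s z≤n) (m<order m)) ⟩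
  order m + order m                  ≤⟨ +-monoʳ-≤ (order m) (m≤m+n (order m) _) ⟩
  order m + (order m + (order m + (order m + 0))) ≡⟨ order-suc m ⟨
  order (suc m)                      ∎
  where open ≤-Reasoning

-- shadow X is X − {0, e₁, …, eₘ}.
shadow : ∀ {m} → (Cube m → Bool) → Cube m → Bool
shadow {zero}  X v       = X v
shadow {suc m} X (a ∷ v) = shadow (slice X a) v ∨ X (inc a ∷ v)

infix 4 _⋖_
-- Adjacency between `V₀` and `V₁` once twins are identified.
_⋖_ : ∀ {m} → Cube m → Cube m → Set
x ⋖ y = y ≡ x ⊎ ∃[ i ] y ≡ x [ i ]%= inc

shadow⇒⋖ : ∀ {m} (X : Cube m → Bool) x → T (shadow X x) → ∃[ y ] T (X y) × x ⋖ y
shadow⇒⋖ {zero}  X x       Xx = x , Xx , inj₁ refl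
shadow⇒⋖ {suc m} X (a ∷ v) h with Equivalence.to (T-∨ {shadow (slice X a) v}) h
... | inj₂ Xiv = inc a ∷ v , Xiv , inj₂ (zero , refl)
... | inj₁ h′ with shadow⇒⋖ (slice X a) v h′
...   | y , Xy , inj₁ refl       = a ∷ y , Xy , inj₁ refl
...   | y , Xy , inj₂ (i , refl) = a ∷ y , Xy , inj₂ (suc i , refl)

⊆-shadow : ∀ {m} (X : Cube m → Bool) v → T (X v) → T (shadow X v)
⊆-shadow {zero}  X v       Xv = Xv
⊆-shadow {suc m} X (a ∷ v) Xv = Equivalence.from T-∨ (inj₁ (⊆-shadow (slice X a) v Xv))

-- c is the size of a slice of X, c⁺ that of the next slice and y that of the
-- corresponding slice of shadow X.
module SliceSizes (N m μ : ℕ) (1≤μ : 1 ≤ μ) (m≤μ : m ≤ μ) (m<N : m < N) where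

  -- The three alternatives of `shadow-expands` one dimension lower, with `μ` in place of `m ⊔ 1`.
  data Kind (c y : ℕ) : Set where
    empty  : c ≡ 0 → Kind c y
    full   : y ≡ N → Kind c y
    medium : 1 ≤ c → c + μ ≤ y → Kind c y

  record Slice (c c⁺ y : ℕ) : Set where
    field
      c≤y  : c ≤ y
      c⁺≤y : c⁺ ≤ y
      y≤N  : y ≤ N
      kind : Kind c y
  open Slice

  total : ℕ → ℕ → ℕ → ℕ → ℕ
  total a b c d = a + (b + (c + (d + 0)))

  total-rotate : ∀ a b c d → b + (c + (d + (a + 0))) ≡ a + (b + (c + (d + 0)))
  total-rotate = solve-∀

  Goal : (c₀ c₁ c₂ c₃ y₀ y₁ y₂ y₃ : ℕ) → Set
  Goal c₀ c₁ c₂ c₃ y₀ y₁ y₂ y₃ =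
    total c₀ c₁ c₂ c₃ ≡ 0 ⊎ total y₀ y₁ y₂ y₃ ≡ total N N N N ⊎
    total c₀ c₁ c₂ c₃ + suc m ≤ total y₀ y₁ y₂ y₃

  Goal-rotate : ∀ c₀ c₁ c₂ c₃ y₀ y₁ y₂ y₃ → Goal c₁ c₂ c₃ c₀ y₁ y₂ y₃ y₀ → Goal c₀ c₁ c₂ c₃ y₀ y₁ y₂ y₃
  Goal-rotate c₀ c₁ c₂ c₃ y₀ y₁ y₂ y₃
    rewrite total-rotate c₀ c₁ c₂ c₃ | total-rotate y₀ y₁ y₂ y₃ = λ g → g

  total-mono : ∀ {a b c d a′ b′ c′ d′} → a ≤ a′ → b ≤ b′ → c ≤ c′ → d ≤ d′ → total a b c d ≤ total a′ b′ c′ d′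
  total-mono p q r s = +-mono-≤ p (+-mono-≤ q (+-mono-≤ r (+-mono-≤ s z≤n)))

  with-slack : ∀ {c₀ c₁ c₂ c₃ y₀ y₁ y₂ y₃} e₀ e₁ e₂ e₃ →
               c₀ + e₀ ≤ y₀ → c₁ + e₁ ≤ y₁ → c₂ + e₂ ≤ y₂ → c₃ + e₃ ≤ y₃ →
               suc m ≤ total e₀ e₁ e₂ e₃ → Goal c₀ c₁ c₂ c₃ y₀ y₁ y₂ y₃
  with-slack {c₀} {c₁} {c₂} {c₃} {y₀} {y₁} {y₂} {y₃} e₀ e₁ e₂ e₃ p₀ p₁ p₂ p₃ enough = inj₂ (inj₂ (begin
    total c₀ c₁ c₂ c₃ + suc m                        ≤⟨ +-monoʳ-≤ (total c₀ c₁ c₂ c₃) enough ⟩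
    total c₀ c₁ c₂ c₃ + total e₀ e₁ e₂ e₃            ≡⟨ total-+ c₀ c₁ c₂ c₃ e₀ e₁ e₂ e₃ ⟩
    total (c₀ + e₀) (c₁ + e₁) (c₂ + e₂) (c₃ + e₃)    ≤⟨ total-mono p₀ p₁ p₂ p₃ ⟩
    total y₀ y₁ y₂ y₃                                ∎))
    where
    open ≤-Reasoning
    total-+ : ∀ a b c d a′ b′ c′ d′ → (a + (b + (c + (d + 0)))) + (a′ + (b′ + (c′ + (d′ + 0))))
              ≡ (a + a′) + ((b + b′) + ((c + c′) + ((d + d′) + 0)))
    total-+ = solve-∀

  0-slack : ∀ {c c⁺ y} → Slice c c⁺ y → c + 0 ≤ y
  0-slack S = ≤-trans (≤-reflexive (+-identityʳ _)) (c≤y S)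

  <-slack : ∀ {c y} → c < y → c + 1 ≤ y
  <-slack {c} c<y = ≤-trans (≤-reflexive (+-comm c 1)) c<y

  -- Because `μ` is positive, a medium slice grows strictly; a nonempty slice without growth is
  -- therefore full.
  ¬slack : ∀ {c c⁺ y} → Slice c c⁺ y → y ≤ c → 1 ≤ c → y ≡ N
  ¬slack S y≤c 1≤c with kind S
  ... | empty refl    = contradiction 1≤c λ ()
  ... | full y≡N      = y≡N
  ... | medium _ c+μ≤y = contradiction
    (≤-trans (+-monoʳ-≤ _ 1≤μ) (≤-trans c+μ≤y y≤c)) (m+1+n≰m _)

  -- The medium slice contributes `m`, so one more unit is needed, and any growth in another slice
  -- supplies it. If there is none, then `c₀ ≤ y₃ ≤ c₃ ≤ y₂ ≤ c₂ ≤ y₁ ≤ c₁`: these three slices are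
  -- nonempty and hence full, and `N = y₁ ≤ c₁ ≤ y₀` fills the first as well.
  medium-first : ∀ {c₀ c₁ c₂ c₃ y₀ y₁ y₂ y₃} → 1 ≤ c₀ → c₀ + μ ≤ y₀ →
                 Slice c₀ c₁ y₀ → Slice c₁ c₂ y₁ → Slice c₂ c₃ y₂ → Slice c₃ c₀ y₃ →
                 Goal c₀ c₁ c₂ c₃ y₀ y₁ y₂ y₃
  medium-first {c₀} {c₁} {c₂} {c₃} {y₀} {y₁} {y₂} {y₃} 1≤c₀ M S₀ S₁ S₂ S₃
    with y₁ ≤? c₁ | y₂ ≤? c₂ | y₃ ≤? c₃ | ≤-trans (+-monoʳ-≤ c₀ m≤μ) M
  ... | no y₁≰c₁ | _ | _ | M′ = with-slack m 1 0 0 M′ (<-slack (≰⇒> y₁≰c₁)) (0-slack S₂) (0-slack S₃)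
    (≤-reflexive (+-comm 1 m))
  ... | yes _ | no y₂≰c₂ | _ | M′ = with-slack m 0 1 0 M′ (0-slack S₁) (<-slack (≰⇒> y₂≰c₂)) (0-slack S₃)
    (≤-reflexive (+-comm 1 m))
  ... | yes _ | yes _ | no y₃≰c₃ | M′ = with-slack m 0 0 1 M′ (0-slack S₁) (0-slack S₂) (<-slack (≰⇒> y₃≰c₃))
    (≤-reflexive (+-comm 1 m))
  ... | yes y₁≤c₁ | yes y₂≤c₂ | yes y₃≤c₃ | _ = inj₂ (inj₁ (cong₂ _+_ y₀≡N (cong₂ _+_ y₁≡N
          (cong₂ _+_ (¬slack S₂ y₂≤c₂ 1≤c₂) (cong (_+ 0) (¬slack S₃ y₃≤c₃ 1≤c₃))))))
    where
    1≤c₃ : 1 ≤ c₃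
    1≤c₃ = ≤-trans 1≤c₀ (≤-trans (c⁺≤y S₃) y₃≤c₃)
    1≤c₂ : 1 ≤ c₂
    1≤c₂ = ≤-trans 1≤c₃ (≤-trans (c⁺≤y S₂) y₂≤c₂)
    1≤c₁ : 1 ≤ c₁
    1≤c₁ = ≤-trans 1≤c₂ (≤-trans (c⁺≤y S₁) y₁≤c₁)
    y₁≡N : y₁ ≡ N
    y₁≡N = ¬slack S₁ y₁≤c₁ 1≤c₁
    y₀≡N : y₀ ≡ N
    y₀≡N = ≤-antisym (y≤N S₀) (≤-trans (≤-reflexive (sym y₁≡N)) (≤-trans y₁≤c₁ (c⁺≤y S₀)))

  -- Charge `c₁` to `y₀`, which the empty slice leaves free. Then all of `y₁ ≡ N` is gain, and `N`
  -- exceeds `m`.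
  empty-full-first : ∀ {c₀ c₁ c₂ c₃ y₀ y₁ y₂ y₃} → c₀ ≡ 0 → y₁ ≡ N →
                     Slice c₀ c₁ y₀ → Slice c₂ c₃ y₂ → Slice c₃ c₀ y₃ →
                     Goal c₀ c₁ c₂ c₃ y₀ y₁ y₂ y₃
  empty-full-first {c₁ = c₁} {c₂} {c₃} {y₀} {y₁} {y₂} {y₃} refl refl S₀ S₂ S₃ = inj₂ (inj₂ (begin
    total 0 c₁ c₂ c₃ + suc m ≡⟨ lemma c₁ c₂ c₃ m ⟩
    total c₁ (suc m) c₂ c₃   ≤⟨ total-mono (c⁺≤y S₀) m<N (c≤y S₂) (c≤y S₃) ⟩
    total y₀ N y₂ y₃         ∎))
    where
    open ≤-Reasoning
    lemma : ∀ b c d e → (0 + (b + (c + (d + 0)))) + suc e ≡ b + (suc e + (c + (d + 0)))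
    lemma = solve-∀

  slices-expand : ∀ {c₀ c₁ c₂ c₃ y₀ y₁ y₂ y₃} →
                  Slice c₀ c₁ y₀ → Slice c₁ c₂ y₁ → Slice c₂ c₃ y₂ → Slice c₃ c₀ y₃ →
                  Goal c₀ c₁ c₂ c₃ y₀ y₁ y₂ y₃
  slices-expand {c₀} {c₁} {c₂} {c₃} {y₀} {y₁} {y₂} {y₃} S₀ S₁ S₂ S₃ =
    cases (kind S₀) (kind S₁) (kind S₂) (kind S₃)
    where
    rotate₁ : Goal c₁ c₂ c₃ c₀ y₁ y₂ y₃ y₀ → Goal c₀ c₁ c₂ c₃ y₀ y₁ y₂ y₃
    rotate₁ = Goal-rotate c₀ c₁ c₂ c₃ y₀ y₁ y₂ y₃
    rotate₂ : Goal c₂ c₃ c₀ c₁ y₂ y₃ y₀ y₁ → Goal c₀ c₁ c₂ c₃ y₀ y₁ y₂ y₃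
    rotate₂ = rotate₁ ∘ Goal-rotate c₁ c₂ c₃ c₀ y₁ y₂ y₃ y₀
    rotate₃ : Goal c₃ c₀ c₁ c₂ y₃ y₀ y₁ y₂ → Goal c₀ c₁ c₂ c₃ y₀ y₁ y₂ y₃
    rotate₃ = rotate₂ ∘ Goal-rotate c₂ c₃ c₀ c₁ y₂ y₃ y₀ y₁
    cases : Kind c₀ y₀ → Kind c₁ y₁ → Kind c₂ y₂ → Kind c₃ y₃ → Goal c₀ c₁ c₂ c₃ y₀ y₁ y₂ y₃
    cases (medium 1≤c M) _ _ _ = medium-first 1≤c M S₀ S₁ S₂ S₃
    cases _ (medium 1≤c M) _ _ = rotate₁ (medium-first 1≤c M S₁ S₂ S₃ S₀)
    cases _ _ (medium 1≤c M) _ = rotate₂ (medium-first 1≤c M S₂ S₃ S₀ S₁)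
    cases _ _ _ (medium 1≤c M) = rotate₃ (medium-first 1≤c M S₃ S₀ S₁ S₂)
    -- With no medium slice left, the cyclic sequence of kinds is constant or has an empty slice
    -- followed by a full one.
    cases (empty e) (full f) _ _ = empty-full-first e f S₀ S₂ S₃
    cases _ (empty e) (full f) _ = rotate₁ (empty-full-first e f S₁ S₃ S₀)
    cases _ _ (empty e) (full f) = rotate₂ (empty-full-first e f S₂ S₀ S₁)
    cases (full f) _ _ (empty e) = rotate₃ (empty-full-first e f S₃ S₁ S₂)
    cases (empty refl) (empty refl) (empty refl) (empty refl) = inj₁ refl
    cases (full refl) (full refl) (full refl) (full refl) = inj₂ (inj₁ refl)

-- Induction on `m`, cutting the cube by its first digit into four cyclically arranged slices: each
-- slice of the shadow contains the shadow of the same slice and a copy of the next slice. Taking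
-- `m ⊔ 1` keeps the growth strict for `m` zero too, as `¬slack` requires.
shadow-expands : ∀ {m} (X : Cube m → Bool) →
  card X ≡ 0 ⊎ card (shadow X) ≡ order m ⊎ card X + (m ⊔ 1) ≤ card (shadow X)
shadow-expands {zero} X with X []
... | true  = inj₂ (inj₁ refl)
... | false = inj₁ refl
shadow-expands {suc m} X
  rewrite card-slices X | card-slices (shadow X) | order-suc m | ⊔-identityʳ m =
  slices-expand (at 0F) (at 1F) (at 2F) (at 3F)
  where
  open SliceSizes (order m) m (m ⊔ 1) (m≤n⊔m m 1) (m≤m⊔n m 1) (m<order m)
  at : ∀ a → Slice (card (slice X a)) (card (slice X (inc a))) (card (slice (shadow X) a))
  at a = record
    { c≤y  = card-mono (slice X a) (slice (shadow X) a) (λ v → ⊆-shadow X (a ∷ v))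
    ; c⁺≤y = card-mono (slice X (inc a)) (slice (shadow X) a) (λ v h → Equivalence.from (T-∨ {shadow (slice X a) v}) (inj₂ h))
    ; y≤N  = card≤order (slice (shadow X) a)
    ; kind = kind′
    }
    where
    shadow-slice⊆ : card (shadow (slice X a)) ≤ card (slice (shadow X) a)
    shadow-slice⊆ = card-mono (shadow (slice X a)) (slice (shadow X) a) (λ v h → Equivalence.from T-∨ (inj₁ h))
    kind′ : Kind (card (slice X a)) (card (slice (shadow X) a))
    kind′ with card (slice X a) ℕ.≟ 0 | shadow-expands (slice X a)
    ... | yes c≡0 | _                = empty c≡0
    ... | no c≢0  | inj₁ c≡0         = empty c≡0
    ... | no _    | inj₂ (inj₁ full′) = full (≤-antisym (card≤order (slice (shadow X) a))
                                         (≤-trans (≤-reflexive (sym full′)) shadow-slice⊆))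
    ... | no c≢0  | inj₂ (inj₂ grows) = medium (n≢0⇒n>0 c≢0) (≤-trans grows shadow-slice⊆)

-- The modular Gray code

infixl 6 _⊞_
_⊞_ : Fin 4 → Fin 4 → Fin 4
a ⊞ b = a ⊕ + toℕ b

inc-⊞ : ∀ a b → inc a ⊞ b ≡ inc (a ⊞ b)
inc-⊞ = toWitness {a? = allᶠ? λ a → allᶠ? λ b → inc a ⊞ b ≟ inc (a ⊞ b)} tt

⊞-inc : ∀ a b → a ⊞ inc b ≡ inc (a ⊞ b)
⊞-inc = toWitness {a? = allᶠ? λ a → allᶠ? λ b → a ⊞ inc b ≟ inc (a ⊞ b)} tt

inc-injective : ∀ {a b} → inc a ≡ inc b → a ≡ b
inc-injective {a} {b} eq = trans (sym (dec-inc a)) (trans (cong dec eq) (dec-inc b))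

digitSum : ∀ {m} → Cube m → Fin 4
digitSum []      = 0F
digitSum (a ∷ v) = a ⊞ digitSum v

-- The successor in the modular Gray code: each step increments one digit, and
-- the leading digit, if not the only one, stands still iff the digit sum is 3.
next prev : ∀ {m} → Cube (suc m) → Cube (suc m)
next {zero}  (a ∷ []) = inc a ∷ []
next {suc m} (a ∷ v) with digitSum (a ∷ v) ≟ 3F
... | yes _ = a ∷ next v
... | no _  = inc a ∷ v
prev {zero}  (a ∷ []) = dec a ∷ []
prev {suc m} (a ∷ v) with digitSum (a ∷ v) ≟ 0F
... | yes _ = a ∷ prev v
... | no _  = dec a ∷ v

-- This makes `next` invertible: the leading digit of several stood still exactly when the new digit
-- sum is 0, which is the test in `prev`.
digitSum-next : ∀ {m} (v : Cube (suc m)) → digitSum (next v) ≡ inc (digitSum v)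
digitSum-next {zero}  (a ∷ []) = inc-⊞ a 0F
digitSum-next {suc m} (a ∷ v) with digitSum (a ∷ v) ≟ 3F
... | yes _ = trans (cong (a ⊞_) (digitSum-next v)) (⊞-inc a (digitSum v))
... | no _  = inc-⊞ a (digitSum v)

digitSum-prev : ∀ {m} (v : Cube (suc m)) → inc (digitSum (prev v)) ≡ digitSum v
digitSum-prev {zero}  (a ∷ []) = trans (sym (inc-⊞ (dec a) 0F)) (cong (_⊞ 0F) (inc-dec a))
digitSum-prev {suc m} (a ∷ v) with digitSum (a ∷ v) ≟ 0F
... | yes _ = trans (sym (⊞-inc a (digitSum (prev v)))) (cong (a ⊞_) (digitSum-prev v))
... | no _  = trans (sym (inc-⊞ (dec a) (digitSum v))) (cong (_⊞ digitSum v) (inc-dec a))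

prev-next : ∀ {m} (v : Cube (suc m)) → prev (next v) ≡ v
prev-next {zero}  (a ∷ []) = cong (_∷ []) (dec-inc a)
prev-next {suc m} (a ∷ v) with digitSum (a ∷ v) ≟ 3F
prev-next {suc m} (a ∷ v) | yes sum≡3 with digitSum (a ∷ next v) ≟ 0F
... | yes _    = cong (a ∷_) (prev-next v)
... | no sum≢0 = contradiction
  (trans (cong (a ⊞_) (digitSum-next v)) (trans (⊞-inc a (digitSum v)) (cong inc sum≡3))) sum≢0
prev-next {suc m} (a ∷ v) | no sum≢3 with digitSum (inc a ∷ v) ≟ 0F
... | yes sum≡0 = contradiction (inc-injective {b = 3F} (trans (sym (inc-⊞ a (digitSum v))) sum≡0)) sum≢3
... | no _      = cong (_∷ v) (dec-inc a)

next-prev : ∀ {m} (v : Cube (suc m)) → next (prev v) ≡ v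
next-prev {zero}  (a ∷ []) = cong (_∷ []) (inc-dec a)
next-prev {suc m} (a ∷ v) with digitSum (a ∷ v) ≟ 0F
next-prev {suc m} (a ∷ v) | yes sum≡0 with digitSum (a ∷ prev v) ≟ 3F
... | yes _    = cong (a ∷_) (next-prev v)
... | no sum≢3 = contradiction (inc-injective {b = 3F} (trans (sym (⊞-inc a (digitSum (prev v))))
                   (trans (cong (a ⊞_) (digitSum-prev v)) sum≡0))) sum≢3
next-prev {suc m} (a ∷ v) | no sum≢0 with digitSum (dec a ∷ v) ≟ 3F
... | yes sum≡3 = contradiction (trans (cong (_⊞ digitSum v) (sym (inc-dec a)))
                   (trans (inc-⊞ (dec a) (digitSum v)) (cong inc sum≡3))) sum≢0
... | no _      = cong (_∷ v) (inc-dec a)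

⋖-next : ∀ {m} (v : Cube (suc m)) → v ⋖ next v
⋖-next {zero}  (a ∷ []) = inj₂ (zero , refl)
⋖-next {suc m} (a ∷ v) with digitSum (a ∷ v) ≟ 3F
... | no _ = inj₂ (zero , refl)
... | yes _ with ⋖-next v
...   | inj₁ eq       = inj₁ (cong (a ∷_) eq)
...   | inj₂ (i , eq) = inj₂ (suc i , cong (a ∷_) eq)

module _ {_≈_ : Rel (Fin 4) 0ℓ} (≈-equiv : IsEquivalence _≈_) (b : Fin 4)
         (step : ∀ a → a ≢ b → a ≈ inc a) where
  private module E = IsEquivalence ≈-equiv

  cut-cycle-connected : ∀ a → a ≈ b
  cut-cycle-connected a with a ≟ b
  ... | yes refl = E.refl
  ... | no p₀ with inc a ≟ b
  ...   | yes refl = step _ p₀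
  ...   | no p₁ with inc (inc a) ≟ b
  ...     | yes refl = E.trans (step _ p₀) (step _ p₁)
  ...     | no p₂ with inc (inc (inc a)) ≟ b
  ...       | yes refl = E.trans (step _ p₀) (E.trans (step _ p₁) (step _ p₂))
  ...       | no p₃ = contradiction (within-three a b) λ where
                (inj₁ e) → p₀ e
                (inj₂ (inj₁ e)) → p₁ e
                (inj₂ (inj₂ (inj₁ e))) → p₂ e
                (inj₂ (inj₂ (inj₂ e))) → p₃ e
    where
    within-three : ∀ a b → a ≡ b ⊎ inc a ≡ b ⊎ inc (inc a) ≡ b ⊎ inc (inc (inc a)) ≡ b
    within-three = toWitness {a? = allᶠ? λ a → allᶠ? λ b →
      a ≟ b ⊎-dec inc a ≟ b ⊎-dec inc (inc a) ≟ b ⊎-dec inc (inc (inc a)) ≟ b} tt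

-- The leading digit that completes a digit sum `z` to 3, where `next` turns to the remaining
-- digits.
turn : Fin 4 → Fin 4
turn z = 3F ⊕ (Sign.- ◃ toℕ z)

turn-⊞ : ∀ z → turn z ⊞ z ≡ 3F
turn-⊞ = toWitness {a? = allᶠ? λ z → turn z ⊞ z ≟ 3F} tt

⊞≡3⇒turn : ∀ a z → a ⊞ z ≡ 3F → a ≡ turn z
⊞≡3⇒turn = toWitness {a? = allᶠ? λ a → allᶠ? λ z → (a ⊞ z ≟ 3F) →-dec (a ≟ turn z)} tt

-- A row fixes all digits but the leading one. Its steps connect it except for the arc out of its
-- corner, and the step at the corner leads into the row of `next v`. The rows are connected by
-- induction, applied to the relation that `_≈_` induces on corners.
gray-code-connected : ∀ {m} {_≈_ : Rel (Cube (suc m)) 0ℓ} → IsEquivalence _≈_ →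
                      (∀ v → v ≈ next v) → ∀ u v → u ≈ v
gray-code-connected {zero} {_≈_} ≈-equiv step (a ∷ []) (b ∷ []) =
  cut-cycle-connected {_≈_ = λ a b → (a ∷ []) ≈ (b ∷ [])}
    (record { refl = E.refl ; sym = E.sym ; trans = E.trans }) b (λ a _ → step (a ∷ [])) a
  where module E = IsEquivalence ≈-equiv
gray-code-connected {suc m} {_≈_} ≈-equiv step (a ∷ u) (b ∷ v) =
  E.trans (in-row a u) (E.trans (rows u v) (E.sym (in-row b v)))
  where
  module E = IsEquivalence ≈-equiv
  corner : Cube (suc m) → Cube (suc (suc m))
  corner v = turn (digitSum v) ∷ v
  step-in-row : ∀ v a → a ≢ turn (digitSum v) → (a ∷ v) ≈ (inc a ∷ v)
  step-in-row v a a≢ with digitSum (a ∷ v) ≟ 3F | step (a ∷ v)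
  ... | yes sum≡3 | _ = contradiction (⊞≡3⇒turn a (digitSum v) sum≡3) a≢
  ... | no _      | h = h
  in-row : ∀ a v → (a ∷ v) ≈ corner v
  in-row a v = cut-cycle-connected {_≈_ = λ a b → (a ∷ v) ≈ (b ∷ v)}
    (record { refl = E.refl ; sym = E.sym ; trans = E.trans }) (turn (digitSum v)) (step-in-row v) a
  next-row : ∀ v → corner v ≈ corner (next v)
  next-row v with digitSum (corner v) ≟ 3F | step (corner v)
  ... | yes _    | h = E.trans h (in-row _ (next v))
  ... | no sum≢3 | _ = contradiction (turn-⊞ (digitSum v)) sum≢3
  rows : ∀ u v → corner u ≈ corner v
  rows = gray-code-connected {_≈_ = λ u v → corner u ≈ corner v}
    (record { refl = E.refl ; sym = E.sym ; trans = E.trans }) next-row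

-- Twins and adjacency in BHₙ

opposite-⊕ : ∀ a σ → a ⊕ (opposite σ ◃ 1) ≡ a ⊕ (σ ◃ 1) ⊕ + 2
opposite-⊕ 0F Sign.- = refl
opposite-⊕ 0F Sign.+ = refl
opposite-⊕ 1F Sign.- = refl
opposite-⊕ 1F Sign.+ = refl
opposite-⊕ 2F Sign.- = refl
opposite-⊕ 2F Sign.+ = refl
opposite-⊕ 3F Sign.- = refl
opposite-⊕ 3F Sign.+ = refl

⊕2-opposite : ∀ a σ → a ⊕ + 2 ⊕ (opposite σ ◃ 1) ≡ a ⊕ (σ ◃ 1)
⊕2-opposite 0F Sign.- = refl
⊕2-opposite 0F Sign.+ = refl
⊕2-opposite 1F Sign.- = refl
⊕2-opposite 1F Sign.+ = refl
⊕2-opposite 2F Sign.- = refl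
⊕2-opposite 2F Sign.+ = refl
⊕2-opposite 3F Sign.- = refl
⊕2-opposite 3F Sign.+ = refl

⊕2-parity : ∀ a → -1ℤ ^ toℕ (a ⊕ + 2) ≡ -1ℤ ^ toℕ a
⊕2-parity 0F = refl
⊕2-parity 1F = refl
⊕2-parity 2F = refl
⊕2-parity 3F = refl

twin : ∀ {m} → Vertex (suc m) → Vertex (suc m)
twin (a ∷ x) = a ⊕ + 2 ∷ x

-- The sign of the move in the first coordinate is free, and reversing it shifts the end by 2.
∼-twinʳ : ∀ {m} {v w : Vertex (suc m)} → v ∼ w → v ∼ twin w
∼-twinʳ (inner a x σ)   = subst (λ b → a ∷ x ∼ b ∷ _) (opposite-⊕ a σ) (inner a x (opposite σ))
∼-twinʳ (outer a x σ i) = subst (λ b → a ∷ x ∼ b ∷ _) (opposite-⊕ a σ) (outer a x (opposite σ) i)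

-- Reversing the sign compensates for the shift by 2 at the start, and the direction of the outer
-- move depends only on the parity of `a`.
∼-twinˡ : ∀ {m} {v w : Vertex (suc m)} → v ∼ w → twin v ∼ w
∼-twinˡ (inner a x σ)   = subst (λ b → a ⊕ + 2 ∷ x ∼ b ∷ _) (⊕2-opposite a σ) (inner (a ⊕ + 2) x (opposite σ))
∼-twinˡ (outer a x σ i) = subst₂ (λ b z → a ⊕ + 2 ∷ x ∼ b ∷ (x [ i ]%= (_⊕ z)))
  (⊕2-opposite a σ) (⊕2-parity a) (outer (a ⊕ + 2) x (opposite σ) i)

infix 4 _≟ᵛ_ _∼?_
_≟ᵛ_ : ∀ {n} (v w : Vertex n) → Dec (v ≡ w)
_≟ᵛ_ = ≡-dec _≟_

_∼?_ : ∀ {m} (v w : Vertex (suc m)) → Dec (v ∼ w)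
(a ∷ x) ∼? w = map′
  (λ { (inj₁ refl) → inner a x Sign.+
     ; (inj₂ (inj₁ refl)) → inner a x Sign.-
     ; (inj₂ (inj₂ (i , inj₁ refl))) → outer a x Sign.+ i
     ; (inj₂ (inj₂ (i , inj₂ refl))) → outer a x Sign.- i })
  (λ { (inner _ _ Sign.+) → inj₁ refl
     ; (inner _ _ Sign.-) → inj₂ (inj₁ refl)
     ; (outer _ _ Sign.+ i) → inj₂ (inj₂ (i , inj₁ refl))
     ; (outer _ _ Sign.- i) → inj₂ (inj₂ (i , inj₂ refl)) })
  (w ≟ᵛ (a ⊕ (Sign.+ ◃ 1) ∷ x) ⊎-dec w ≟ᵛ (a ⊕ (Sign.- ◃ 1) ∷ x) ⊎-dec
   anyᶠ? (λ i → w ≟ᵛ (a ⊕ (Sign.+ ◃ 1) ∷ (x [ i ]%= (_⊕ (-1ℤ ^ toℕ a)))) ⊎-dec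
                w ≟ᵛ (a ⊕ (Sign.- ◃ 1) ∷ (x [ i ]%= (_⊕ (-1ℤ ^ toℕ a))))))

data Even {m} : Vertex (suc m) → Set where
  even₀ : ∀ {x} → Even (0F ∷ x)
  even₂ : ∀ {x} → Even (2F ∷ x)

data Odd {m} : Vertex (suc m) → Set where
  odd₁ : ∀ {x} → Odd (1F ∷ x)
  odd₃ : ∀ {x} → Odd (3F ∷ x)

V₀⇒Even : ∀ {m} (v : Vertex (suc m)) → V₀ v → Even v
V₀⇒Even (0F ∷ x) _ = even₀
V₀⇒Even (1F ∷ x) h = contradiction h (from-no (2 ∣? 1))
V₀⇒Even (2F ∷ x) _ = even₂
V₀⇒Even (3F ∷ x) h = contradiction h (from-no (2 ∣? 3))

V₁⇒Odd : ∀ {m} (v : Vertex (suc m)) → V₁ v → Odd v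
V₁⇒Odd (0F ∷ x) h = contradiction (divides 0 refl) h
V₁⇒Odd (1F ∷ x) _ = odd₁
V₁⇒Odd (2F ∷ x) h = contradiction (divides 1 refl) h
V₁⇒Odd (3F ∷ x) _ = odd₃

Even⇒¬Odd : ∀ {m} {v : Vertex (suc m)} → Even v → ¬ Odd v
Even⇒¬Odd even₀ ()
Even⇒¬Odd even₂ ()

∼-Odd⇒Even : ∀ {m} {v w : Vertex (suc m)} → v ∼ w → Odd v → Even w
∼-Odd⇒Even (inner _ _ Sign.+) odd₁ = even₂
∼-Odd⇒Even (inner _ _ Sign.-) odd₁ = even₀
∼-Odd⇒Even (inner _ _ Sign.+) odd₃ = even₀
∼-Odd⇒Even (inner _ _ Sign.-) odd₃ = even₂
∼-Odd⇒Even (outer _ _ Sign.+ _) odd₁ = even₂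
∼-Odd⇒Even (outer _ _ Sign.- _) odd₁ = even₀
∼-Odd⇒Even (outer _ _ Sign.+ _) odd₃ = even₀
∼-Odd⇒Even (outer _ _ Sign.- _) odd₃ = even₂

⋖⇒∼ : ∀ {m} {x y : Cube m} → x ⋖ y → (0F ∷ x) ∼ (1F ∷ y)
⋖⇒∼ (inj₁ refl)       = inner 0F _ Sign.+
⋖⇒∼ (inj₂ (i , refl)) = outer 0F _ Sign.+ i

-- An odd first coordinate makes the outer move a decrement, which undoes the increment from `x` to
-- `y`.
⋖⇒∼-reverse : ∀ {m} {x y : Cube m} → x ⋖ y → (1F ∷ y) ∼ (0F ∷ x)
⋖⇒∼-reverse (inj₁ refl) = inner 1F _ Sign.-
⋖⇒∼-reverse {x = x} (inj₂ (i , refl)) =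
  subst (λ z → 1F ∷ (x [ i ]%= inc) ∼ 0F ∷ z)
    (trans ([]%=-∘ x i) (updateAt-id-local i x (dec-inc _)))
    (outer 1F (x [ i ]%= inc) Sign.- i)

⋖⇒∼-odd-even : ∀ {m a b} {x y : Cube m} → x ⋖ y → Odd (a ∷ y) → Even (b ∷ x) → (a ∷ y) ∼ (b ∷ x)
⋖⇒∼-odd-even x⋖y odd₁ even₀ = ⋖⇒∼-reverse x⋖y
⋖⇒∼-odd-even x⋖y odd₁ even₂ = ∼-twinʳ (⋖⇒∼-reverse x⋖y)
⋖⇒∼-odd-even x⋖y odd₃ even₀ = ∼-twinˡ (⋖⇒∼-reverse x⋖y)
⋖⇒∼-odd-even x⋖y odd₃ even₂ = ∼-twinʳ (∼-twinˡ (⋖⇒∼-reverse x⋖y))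

-- With twins identified, the arcs out of `0F ∷ x` and `2F ∷ x` join the class of `x` in `V₀` to
-- those of `x` and `next x` in `V₁`; together they form the Hamiltonian cycle. The arcs out of `V₁`
-- are the initial perfect matching.
base : ∀ {m} → Vertex (2 + m) ↔ Vertex (2 + m)
base {m} = mk↔ₛ′ to′ from′ to∘from from∘to
  where
  to′ from′ : Vertex (2 + m) → Vertex (2 + m)
  to′ (0F ∷ x) = 1F ∷ x
  to′ (1F ∷ x) = 0F ∷ x
  to′ (2F ∷ x) = 3F ∷ next x
  to′ (3F ∷ x) = 2F ∷ x
  from′ (0F ∷ x) = 1F ∷ x
  from′ (1F ∷ x) = 0F ∷ x
  from′ (2F ∷ x) = 3F ∷ x
  from′ (3F ∷ x) = 2F ∷ prev x
  to∘from : ∀ v → to′ (from′ v) ≡ v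
  to∘from (0F ∷ x) = refl
  to∘from (1F ∷ x) = refl
  to∘from (2F ∷ x) = refl
  to∘from (3F ∷ x) = cong (3F ∷_) (next-prev x)
  from∘to : ∀ v → from′ (to′ v) ≡ v
  from∘to (0F ∷ x) = refl
  from∘to (1F ∷ x) = refl
  from∘to (2F ∷ x) = cong (2F ∷_) (prev-next x)
  from∘to (3F ∷ x) = refl

-- The edges V₀ → V₁ are frozen along a Hamiltonian cycle of the quotient by
-- twins; only the edges V₁ → V₀ are free.
Allowed : ∀ {m} → Vertex (2 + m) → Vertex (2 + m) → Set
Allowed v@(0F ∷ _) w = w ≡ to base v
Allowed v@(1F ∷ _) w = v ∼ w
Allowed v@(2F ∷ _) w = w ≡ to base v
Allowed v@(3F ∷ _) w = v ∼ w

Allowed? : ∀ {m} (v w : Vertex (2 + m)) → Dec (Allowed v w)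
Allowed? v@(0F ∷ _) w = w ≟ᵛ to base v
Allowed? v@(1F ∷ _) w = v ∼? w
Allowed? v@(2F ∷ _) w = w ≟ᵛ to base v
Allowed? v@(3F ∷ _) w = v ∼? w

Allowed-base : ∀ {m} (v : Vertex (2 + m)) → Allowed v (to base v)
Allowed-base (0F ∷ x) = refl
Allowed-base (1F ∷ x) = inner 1F x Sign.-
Allowed-base (2F ∷ x) = refl
Allowed-base (3F ∷ x) = inner 3F x Sign.-

Allowed⇒∼ : ∀ {m} (v : Vertex (2 + m)) {w} → Allowed v w → v ∼ w
Allowed⇒∼ (0F ∷ x) refl = ⋖⇒∼ {y = x} (inj₁ refl)
Allowed⇒∼ (1F ∷ x) v∼w  = v∼w
Allowed⇒∼ (2F ∷ x) refl = ∼-twinʳ (∼-twinˡ (⋖⇒∼ (⋖-next x)))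
Allowed⇒∼ (3F ∷ x) v∼w  = v∼w

Allowed-odd : ∀ {m} {v w : Vertex (2 + m)} → Odd v → v ∼ w → Allowed v w
Allowed-odd odd₁ v∼w = v∼w
Allowed-odd odd₃ v∼w = v∼w

Allowed-even : ∀ {m} (v : Vertex (2 + m)) {w} → Allowed v w → Even w → Odd v
Allowed-even (0F ∷ x) refl ()
Allowed-even (1F ∷ x) _ _ = odd₁
Allowed-even (2F ∷ x) refl ()
Allowed-even (3F ∷ x) _ _ = odd₃

-- The covering permutation in dimension `2 + m`.

module Cover (m k : ℕ) (k≤ : k ≤ 2 * suc m) (s t : Fin k → Vertex (2 + m))
             (s-injective : Injective _≡_ _≡_ s) (s-even : ∀ i → Even (s i))
             (t-injective : Injective _≡_ _≡_ t) (t-odd : ∀ i → Odd (t i)) where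

  V : Set
  V = Vertex (2 + m)

  open FinitePermutation {V} _≟ᵛ_ (allCube (2 + m)) ∈-allCube
  open DecMembership (_≟ᵛ_ {2 + m}) using (_∈?_)

  Ordinary : List (Fin k) → Rel V 0ℓ
  Ordinary is v w = All (λ i → v ≢ t i) is × All (λ i → w ≢ s i) is × Allowed v w

  -- For `i` in `is`, `t i` is related only to `s i`, and `s i` only to `t i`; a repair within this
  -- relation therefore cannot destroy earlier forced arcs.
  Forced : List (Fin k) → Rel V 0ℓ
  Forced is v w = Any (λ i → v ≡ t i × w ≡ s i) is ⊎ Ordinary is v w

  Forced? : ∀ is v w → Dec (Forced is v w)
  Forced? is v w = Any.any? (λ i → v ≟ᵛ t i ×-dec w ≟ᵛ s i) is ⊎-dec
    (All.all? (λ i → ¬? (v ≟ᵛ t i)) is ×-dec All.all? (λ i → ¬? (w ≟ᵛ s i)) is ×-dec Allowed? v w)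

  Forced-∷ : ∀ {is i v w} → v ≢ t i → w ≢ s i → Forced is v w → Forced (i ∷ is) v w
  Forced-∷ v≢t w≢s (inj₁ forced)            = inj₁ (there forced)
  Forced-∷ v≢t w≢s (inj₂ (v∉t , w∉s , edge)) = inj₂ (v≢t ∷ v∉t , w≢s ∷ w∉s , edge)

  Forced-s : ∀ {is i v} → All (i ≢_) is → Forced is v (s i) → Ordinary is v (s i)
  Forced-s i∉is (inj₂ o) = o
  Forced-s i∉is (inj₁ forced) with find forced
  ... | j , j∈is , _ , si≡sj = contradiction (s-injective si≡sj) (All.lookup i∉is j∈is)

  Forced-t : ∀ {is i w} → All (i ≢_) is → Forced is (t i) w → Ordinary is (t i) w
  Forced-t i∉is (inj₂ o) = o
  Forced-t i∉is (inj₁ forced) with find forced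
  ... | j , j∈is , ti≡tj , _ = contradiction (t-injective ti≡tj) (All.lookup i∉is j∈is)

  Forced-t∈ : ∀ {is i w} → i ∈ is → Forced is (t i) w → w ≡ s i
  Forced-t∈ i∈is (inj₂ (ti∉t , _)) = contradiction refl (All.lookup ti∉t i∈is)
  Forced-t∈ i∈is (inj₁ forced) with find forced
  ... | j , j∈is , ti≡tj , w≡sj = trans w≡sj (cong s (sym (t-injective ti≡tj)))

  -- A set closed under alternating steps is too small for the expansion of BHₙ.
  module Blocked (is : List (Fin k)) (is! : Unique is) (π : V ↔ V) (bad : V)
                 (good : ∀ v → v ≢ bad → Forced is v (to π v))
                 (bad-odd : Odd bad) (bad∉t : All (λ i → bad ≢ t i) is) (πbad-even : Even (to π bad))
                 (X : List V) (bad∈X : bad ∈ X)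
                 (closed : Repair.Closed (Forced is) (Forced? is) π bad good X) where

    Member : V → Set
    Member v = v ∈ X × All (λ i → v ≢ t i) is

    Member? : ∀ v → Dec (Member v)
    Member? v = v ∈? X ×-dec All.all? (λ i → ¬? (v ≟ᵛ t i)) is

    -- Expansion is available only in the twin quotient. `Qs` lifts this set back to both twins, so
    -- it may contain vertices outside `X`.
    Q : Cube (suc m) → Bool
    Q y = isYes (Member? (1F ∷ y)) ∨ isYes (Member? (3F ∷ y))

    Q⁺ : ∀ {a y} → Odd (a ∷ y) → Member (a ∷ y) → T (Q y)
    Q⁺ {y = y} odd₁ h = Equivalence.from T-∨ (inj₁ (fromWitness {a? = Member? (1F ∷ y)} h))
    Q⁺ {y = y} odd₃ h = Equivalence.from (T-∨ {isYes (Member? (1F ∷ y))}) (inj₂ (fromWitness {a? = Member? (3F ∷ y)} h))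

    Q⁻ : ∀ {y} → T (Q y) → ∃[ a ] Odd (a ∷ y) × Member (a ∷ y)
    Q⁻ {y} h with Equivalence.to (T-∨ {isYes (Member? (1F ∷ y))}) h
    ... | inj₁ h₁ = 1F , odd₁ , toWitness {a? = Member? (1F ∷ y)} h₁
    ... | inj₂ h₃ = 3F , odd₃ , toWitness {a? = Member? (3F ∷ y)} h₃

    π-t : ∀ {i} → i ∈ is → to π (t i) ≡ s i
    π-t i∈is = Forced-t∈ i∈is (good _ λ t≡bad → All.lookup bad∉t i∈is (sym t≡bad))

    πbad∉s : All (λ i → to π bad ≢ s i) is
    πbad∉s = All.tabulate λ i∈is πbad≡s →
      All.lookup bad∉t i∈is (to-injective π (trans πbad≡s (sym (π-t i∈is))))

    -- An arc into `V₀` that is not forced can only come from `V₁`, because the allowed arcs out of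
    -- `V₀` end in `V₁`.
    preimage-free : ∀ v → Even (to π v) → All (λ i → to π v ≢ s i) is →
                    Odd v × All (λ i → v ≢ t i) is
    preimage-free v even ∉s with v ≟ᵛ bad
    ... | yes refl = bad-odd , bad∉t
    ... | no v≢bad with good v v≢bad
    ...   | inj₂ (v∉t , _ , edge) = Allowed-even v edge even , v∉t
    ...   | inj₁ forced with find forced
    ...     | i , i∈is , _ , πv≡s = contradiction πv≡s (All.lookup ∉s i∈is)

    Qs shadows images : List V
    Qs      = map (1F ∷_) (elements Q) ++ map (3F ∷_) (elements Q)
    shadows = map (0F ∷_) (elements (shadow Q)) ++ map (2F ∷_) (elements (shadow Q))
    images  = map s is ++ map (to π) Qs

    ∈-Qs : ∀ {v} → Odd v → Member v → v ∈ Qs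
    ∈-Qs odd@odd₁ h = ∈-++⁺ˡ (∈-map⁺ (1F ∷_) (∈-elements Q (Q⁺ odd h)))
    ∈-Qs odd@odd₃ h = ∈-++⁺ʳ (map (1F ∷_) (elements Q)) (∈-map⁺ (3F ∷_) (∈-elements Q (Q⁺ odd h)))

    -- Such a vertex is a forced `s i`, or it is related to a member of `X` whatever twins are
    -- chosen. In the latter case closedness puts its preimage into `X` and away from `bad`, and
    -- `preimage-free` makes that preimage a member.
    shadow-image : ∀ {b x} → Even (b ∷ x) → T (shadow Q x) → b ∷ x ≢ to π bad × b ∷ x ∈ images
    shadow-image {b} {x} even h with shadow⇒⋖ Q x h
    ... | y , Qy , x⋖y with Q⁻ Qy
    ...   | a , odd , a∷y∈X , a∷y∉t with Any.any? (λ i → b ∷ x ≟ᵛ s i) is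
    ...     | yes b∷x∈s with find b∷x∈s
    ...       | i , i∈is , b∷x≡s = (λ eq → All.lookup πbad∉s i∈is (trans (sym eq) b∷x≡s)) ,
                  ∈-++⁺ˡ (subst (_∈ map s is) (sym b∷x≡s) (∈-map⁺ s i∈is))
    shadow-image {b} {x} even h | y , Qy , x⋖y | a , odd , a∷y∈X , a∷y∉t | no b∷x∉s =
      (λ eq → v≢bad (to-injective π (trans πv≡ eq))) ,
      ∈-++⁺ʳ (map s is) (subst (_∈ map (to π) Qs) πv≡ (∈-map⁺ (to π) (∈-Qs v-odd (v∈X , v∉t))))
      where
      v = from π (b ∷ x)
      πv≡ : to π v ≡ b ∷ x
      πv≡ = strictlyInverseˡ π (b ∷ x)
      edge : Forced is (a ∷ y) (b ∷ x)
      edge = inj₂ (a∷y∉t , ¬Any⇒All¬ is b∷x∉s , Allowed-odd odd (⋖⇒∼-odd-even x⋖y odd even))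
      in-X : v ∈ X × v ≢ bad
      in-X = closed a∷y∈X (subst (Forced is (a ∷ y)) (sym πv≡) edge)
      v∈X : v ∈ X
      v∈X = proj₁ in-X
      v≢bad : v ≢ bad
      v≢bad = proj₂ in-X
      free : Odd v × All (λ i → v ≢ t i) is
      free = preimage-free v (subst Even (sym πv≡) even)
        (subst (λ w → All (λ i → w ≢ s i) is) (sym πv≡) (¬Any⇒All¬ is b∷x∉s))
      v-odd : Odd v
      v-odd = proj₁ free
      v∉t : All (λ i → v ≢ t i) is
      v∉t = proj₂ free

    ∈-shadows : ∀ {v} → v ∈ shadows → v ≢ to π bad × v ∈ images
    ∈-shadows v∈ with ∈-++⁻ (map (0F ∷_) (elements (shadow Q))) v∈
    ... | inj₁ v∈₀ with ∈-map⁻ (0F ∷_) v∈₀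
    ...   | x , x∈ , refl = shadow-image even₀ (elements-sound (shadow Q) x∈)
    ∈-shadows v∈ | inj₂ v∈₂ with ∈-map⁻ (2F ∷_) v∈₂
    ...   | x , x∈ , refl = shadow-image even₂ (elements-sound (shadow Q) x∈)

    shadows-unique : Unique shadows
    shadows-unique = unique-++⁺ (unique-map⁺ ∷-injectiveʳ (elements-unique (shadow Q)))
                                (unique-map⁺ ∷-injectiveʳ (elements-unique (shadow Q)))
      λ (v∈₀ , v∈₂) → case ∈-map⁻ (0F ∷_) v∈₀ , ∈-map⁻ (2F ∷_) v∈₂ of λ where
        ((_ , _ , refl) , (_ , _ , ()))

    bad∈Qs : bad ∈ Qs
    bad∈Qs = ∈-Qs bad-odd (bad∈X , bad∉t)

    length-twice : ∀ {a b} (X : Cube (suc m) → Bool) →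
                   length (map (a ∷_) (elements X) ++ map (b ∷_) (elements X)) ≡ card X + card X
    length-twice {a} {b} X = trans (length-++ (map (a ∷_) (elements X)))
      (cong₂ _+_ (length-map (a ∷_) (elements X)) (length-map (b ∷_) (elements X)))

    length-is≤ : length is ≤ suc m + suc m
    length-is≤ = begin
      length is         ≤⟨ unique-⊆⇒length≤ is! (λ {i} _ → ∈-allFin i) ⟩
      length (allFin k) ≡⟨ length-tabulate id ⟩
      k                 ≤⟨ k≤ ⟩
      2 * suc m         ≡⟨ cong (λ z → suc m + z) (+-identityʳ (suc m)) ⟩
      suc m + suc m     ∎
      where open ≤-Reasoning

    -- The extra unit is `to π bad`: it lies in `images`, as `bad` is in `Qs`, but not in `shadows`.
    count : suc (card (shadow Q) + card (shadow Q)) ≤ (suc m + suc m) + (card Q + card Q)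
    count = begin
      suc (card (shadow Q) + card (shadow Q))     ≡⟨ cong suc (length-twice (shadow Q)) ⟨
      length (to π bad ∷ shadows)                 ≤⟨ unique-⊆⇒length≤
                                                       (All.tabulate (λ v∈ eq → proj₁ (∈-shadows v∈) (sym eq)) ∷ shadows-unique)
                                                       (λ { (here refl) → ∈-++⁺ʳ (map s is) (∈-map⁺ (to π) bad∈Qs)
                                                          ; (there v∈) → proj₂ (∈-shadows v∈) }) ⟩
      length images                               ≡⟨ length-++ (map s is) ⟩
      length (map s is) + length (map (to π) Qs)  ≡⟨ cong₂ _+_ (length-map s is) (trans (length-map (to π) Qs) (length-twice Q)) ⟩
      length is + (card Q + card Q)               ≤⟨ +-monoˡ-≤ _ length-is≤ ⟩
      (suc m + suc m) + (card Q + card Q)         ∎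
      where open ≤-Reasoning

    Q-nonempty : 0 < card Q
    Q-nonempty = nonempty bad-odd (bad∈X , bad∉t)
      where
      nonempty : ∀ {v} → Odd v → Member v → 0 < card Q
      nonempty odd@odd₁ h = card-nonempty Q (Q⁺ odd h)
      nonempty odd@odd₃ h = card-nonempty Q (Q⁺ odd h)

    -- Otherwise the even vertex `to π bad` would lie over the shadow, which `shadow-image`
    -- excludes.
    not-full : card (shadow Q) ≢ order (suc m)
    not-full full = absurd (to π bad) refl πbad-even
      where
      absurd : ∀ v → v ≡ to π bad → ¬ Even v
      absurd (b ∷ x) eq even = proj₁ (shadow-image even (card-full (shadow Q) full x)) eq

    impossible : ¬ (card Q + (suc m ⊔ 1) ≤ card (shadow Q))
    impossible grows = 1+n≰n (begin
      suc (card (shadow Q) + card (shadow Q))  ≤⟨ count ⟩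
      (suc m + suc m) + (card Q + card Q)      ≡⟨ rearrange (suc m) (card Q) ⟩
      (card Q + suc m) + (card Q + suc m)      ≤⟨ +-mono-≤ grows′ grows′ ⟩
      card (shadow Q) + card (shadow Q)        ∎)
      where
      open ≤-Reasoning
      grows′ : card Q + suc m ≤ card (shadow Q)
      grows′ = ≤-trans (+-monoʳ-≤ (card Q) (m≤m⊔n (suc m) 1)) grows
      rearrange : ∀ a b → (a + a) + (b + b) ≡ (b + a) + (b + a)
      rearrange = solve-∀

    blocked : ∀ {A : Set} → A
    blocked with shadow-expands Q
    ... | inj₁ empty        = contradiction (sym empty) (<⇒≢ Q-nonempty)
    ... | inj₂ (inj₁ full)  = contradiction full not-full
    ... | inj₂ (inj₂ grows) = contradiction grows impossible

  -- To add `i`, exchange the images of `t i` and of the current preimage `bad` of `s i`. Only the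
  -- new arc out of `bad` can then fail, and the search for its repair cannot be blocked.
  force : ∀ is → Unique is → Σ[ π ∈ V ↔ V ] (∀ v → Forced is v (to π v))
  force [] _ = base , λ v → inj₂ ([] , [] , Allowed-base v)
  force (i ∷ is) (i∉is ∷ is!) with force is is!
  ... | π , ok with from π (s i) ≟ᵛ t i
  ...   | yes πt≡s = π , λ v → case v ≟ᵛ t i of λ where
            (yes refl) → inj₁ (here (refl , trans (cong (to π) (sym πt≡s)) (strictlyInverseˡ π (s i))))
            (no v≢t)   → Forced-∷ v≢t (λ πv≡s → v≢t (trans (sym (strictlyInverseʳ π v)) (trans (cong (from π) πv≡s) πt≡s))) (ok v)
  ...   | no bad≢t = result
    where
    bad : V
    bad = from π (s i)
    π′ : V ↔ V
    π′ = π ∘⟨ t i ↔ bad ⟩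
    πbad≡s : to π bad ≡ s i
    πbad≡s = strictlyInverseˡ π (s i)
    good : ∀ v → v ≢ bad → Forced (i ∷ is) v (to π′ v)
    good = exchange-elim (λ v w → v ≢ bad → Forced (i ∷ is) v (to π w))
      (λ _ → inj₁ (here (refl , πbad≡s)))
      (λ bad≢bad → contradiction refl bad≢bad)
      (λ {v} v≢t _ v≢bad → Forced-∷ v≢t
        (λ πv≡s → v≢bad (to-injective π (trans πv≡s (sym πbad≡s)))) (ok v))
    -- As `i` is not yet forced, the old arcs into `s i` and out of `t i` are ordinary. They give
    -- the parities of `bad` and of its new image that `Blocked` needs.
    bad-edge : Ordinary is bad (s i)
    bad-edge = Forced-s i∉is (subst (Forced is bad) πbad≡s (ok bad))
    bad-odd : Odd bad
    bad-odd = Allowed-even bad (proj₂ (proj₂ bad-edge)) (s-even i)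
    π′bad-even : Even (to π′ bad)
    π′bad-even = subst Even (cong (to π) (sym (exchange-right (t i) bad)))
      (∼-Odd⇒Even (Allowed⇒∼ (t i) (proj₂ (proj₂ (Forced-t i∉is (ok (t i)))))) (t-odd i))
    result : Σ[ ρ ∈ V ↔ V ] (∀ v → Forced (i ∷ is) v (to ρ v))
    result with Repair.outcome (Forced (i ∷ is)) (Forced? (i ∷ is)) π′ bad good
    ... | inj₁ repaired = repaired
    ... | inj₂ (X , bad∈X , closed) =
      Blocked.blocked (i ∷ is) (i∉is ∷ is!) π′ bad good bad-odd (bad≢t ∷ proj₁ bad-edge) π′bad-even
                      X bad∈X closed

  -- Merging all orbits into one.

  Step : Rel V 0ℓ
  Step v w = (∃[ i ] v ≡ t i × w ≡ s i) ⊎ ((∀ i → v ≢ t i) × v ∼ w)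

  even∉t : ∀ {v} → Even v → ∀ i → v ≢ t i
  even∉t even i refl = Even⇒¬Odd even (t-odd i)

  Step-twinˡ : ∀ {v w} → Even v → Even (twin v) → Step v w → Step (twin v) w
  Step-twinˡ even even′ (inj₁ (i , v≡t , _)) = contradiction v≡t (even∉t even i)
  Step-twinˡ even even′ (inj₂ (_ , v∼w))     = inj₂ (even∉t even′ , ∼-twinˡ v∼w)

  Step-twinʳ : ∀ {v w} → Odd w → Step v w → Step v (twin w)
  Step-twinʳ odd (inj₁ (i , _ , refl)) = contradiction odd (Even⇒¬Odd (s-even i))
  Step-twinʳ odd (inj₂ (v∉t , v∼w))    = inj₂ (v∉t , ∼-twinʳ v∼w)

  TwinsJoined : V ↔ V → Cube (suc m) → Set
  TwinsJoined ρ x = (0F ∷ x ⟶[ ρ ] 2F ∷ x) × (1F ∷ x ⟶[ ρ ] 3F ∷ x)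

  -- The exchanges leave every arc from `t i` to `s i` alone: even twins trade images and are never
  -- terminals `t i`, while odd twins trade preimages and are never sources `s i`. Since merging
  -- only enlarges orbits, pairs joined earlier stay joined.
  join-twins : ∀ (π : V ↔ V) → (∀ v → Step v (to π v)) → ∀ xs →
               Σ[ ρ ∈ V ↔ V ] (∀ v → Step v (to ρ v)) × π ⊑ ρ × All (TwinsJoined ρ) xs
  join-twins π ok [] = π , ok , id , []
  join-twins π ok (x ∷ xs) with join-twins π ok xs
  ... | π₁ , ok₁ , π⊑π₁ , joined
    with merge Step π₁ (0F ∷ x) (2F ∷ x) ok₁
           (Step-twinˡ even₂ even₀ (ok₁ (2F ∷ x))) (Step-twinˡ even₀ even₂ (ok₁ (0F ∷ x)))
  ...   | π₂ , ok₂ , π₁⊑π₂ , 0⟶2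
    -- This joins the preimages of the odd twins; `arrives` carries the connection over to the twins
    -- themselves.
    with merge Step π₂ (from π₂ (1F ∷ x)) (from π₂ (3F ∷ x)) ok₂
           (crossed odd₁ (strictlyInverseˡ π₂ _) (strictlyInverseˡ π₂ _))
           (crossed odd₃ (strictlyInverseˡ π₂ _) (strictlyInverseˡ π₂ _))
    where
    crossed : ∀ {u v w} → Odd w → to π₂ u ≡ w → to π₂ v ≡ twin w → Step u (to π₂ v)
    crossed {u} odd refl eq = subst (Step u) (sym eq) (Step-twinʳ odd (ok₂ u))
  ...     | π₃ , ok₃ , π₂⊑π₃ , 1⟶3 = π₃ , ok₃ , π₂⊑π₃ ∘ π₁⊑π₂ ∘ π⊑π₁ ,
    (π₂⊑π₃ 0⟶2 , ⟶-sym π₃ (arrives (1F ∷ x)) ◅◅ 1⟶3 ◅◅ arrives (3F ∷ x)) ∷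
    All.map (λ (p , q) → π₂⊑π₃ (π₁⊑π₂ p) , π₂⊑π₃ (π₁⊑π₂ q)) joined
    where
    arrives : ∀ v → from π₂ v ⟶[ π₃ ] v
    arrives v = π₂⊑π₃ (strictlyInverseˡ π₂ v ◅ ε)

  abstract
    initial : Σ[ π ∈ V ↔ V ] (∀ v → Forced (allFin k) v (to π v))
    initial = force (allFin k) (allFin⁺ k)

  π₀ : V ↔ V
  π₀ = proj₁ initial

  π₀-step : ∀ v → Step v (to π₀ v)
  π₀-step v with proj₂ initial v
  ... | inj₁ forced           = inj₁ (let (i , _ , eqs) = find forced in i , eqs)
  ... | inj₂ (v∉t , _ , edge) = inj₂ ((λ i → All.lookup v∉t (∈-allFin i)) , Allowed⇒∼ v edge)

  π₀-even : ∀ {v} → Even v → to π₀ v ≡ to base v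
  π₀-even {v} even with proj₂ initial v
  ... | inj₁ forced = let (i , _ , v≡t , _) = find forced in contradiction v≡t (even∉t even i)
  π₀-even even₀ | inj₂ (_ , _ , edge) = edge
  π₀-even even₂ | inj₂ (_ , _ , edge) = edge

  abstract
    joined : Σ[ ρ ∈ V ↔ V ] (∀ v → Step v (to ρ v)) × π₀ ⊑ ρ × All (TwinsJoined ρ) (allCube (suc m))
    joined = join-twins π₀ π₀-step (allCube (suc m))

  ρ : V ↔ V
  ρ = proj₁ joined

  ρ-step : ∀ v → Step v (to ρ v)
  ρ-step = proj₁ (proj₂ joined)

  ρ-twins : ∀ x → TwinsJoined ρ x
  ρ-twins x = All.lookup (proj₂ (proj₂ (proj₂ joined))) (∈-allCube x)

  -- Merging may have replaced the arc from `v` to `to base v`, but its ends remain in one orbit.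
  ρ-base : ∀ {v} → Even v → v ⟶[ ρ ] to base v
  ρ-base even = proj₁ (proj₂ (proj₂ joined)) (π₀-even even ◅ ε)

  ρ-zeros : ∀ x y → 0F ∷ x ⟶[ ρ ] 0F ∷ y
  ρ-zeros = gray-code-connected
    (record { refl = ε ; sym = ⟶-sym ρ ; trans = _◅◅_ })
    -- Pass from `0F ∷ x` to its twin, along the Hamiltonian cycle to `3F ∷ next x`, to the twin of
    -- that, and back along the cycle to `0F ∷ next x`.
    λ x → proj₁ (ρ-twins x) ◅◅ ρ-base even₂ ◅◅ ⟶-sym ρ (proj₂ (ρ-twins (next x))) ◅◅ ⟶-sym ρ (ρ-base even₀)

  ρ-from-zero : ∀ a x → 0F ∷ x ⟶[ ρ ] a ∷ x
  ρ-from-zero 0F x = ε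
  ρ-from-zero 1F x = ρ-base even₀
  ρ-from-zero 2F x = proj₁ (ρ-twins x)
  ρ-from-zero 3F x = ρ-base even₀ ◅◅ proj₂ (ρ-twins x)

  ρ-transitive : ∀ u v → u ⟶[ ρ ] v
  ρ-transitive (a ∷ x) (b ∷ y) = ⟶-sym ρ (ρ-from-zero a x) ◅◅ ρ-zeros x y ◅◅ ρ-from-zero b y

  ρ-t : ∀ i → to ρ (t i) ≡ s i
  ρ-t i with ρ-step (t i)
  ... | inj₁ (j , t≡t , eq) = trans eq (cong s (sym (t-injective t≡t)))
  ... | inj₂ (t∉t , _)      = contradiction refl (t∉t i)

  ρ-edge : ∀ {v} → (∀ i → v ≢ t i) → v ∼ to ρ v
  ρ-edge {v} v∉t with ρ-step v
  ... | inj₁ (i , v≡t , _) = contradiction v≡t (v∉t i)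
  ... | inj₂ (_ , v∼ρv)    = v∼ρv

  module Paths (i₀ : Fin k) =
    CutCycle _∼_ s t s-injective t-injective ρ ρ-t ρ-edge i₀ ρ-transitive

theorem8 : ∀ (n : ℕ) → 2 ≤ n →
    (s t : Fin (2 * n ∸ 2) → Vertex n) →
    Injective _≡_ _≡_ s → (∀ i → V₀ (s i)) →
    Injective _≡_ _≡_ t → (∀ i → V₁ (t i)) →
    Σ[ ψ ∈ Permutation′ (2 * n ∸ 2) ]
    Σ[ P ∈ (∀ i → Path _∼_ (s i) (t (ψ ⟨$⟩ʳ i))) ]
    (∀ i j → i ≢ j → Disjoint (vertices (P i)) (vertices (P j))) ×
    (∀ v → ∃[ i ] v ∈ vertices (P i))
theorem8 (suc (suc m)) (s≤s (s≤s z≤n)) s t s-injective s∈V₀ t-injective t∈V₁ =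
  ψ , path , paths-disjoint , paths-cover
  where
  count≡ : 2 * suc (suc m) ∸ 2 ≡ 2 * suc m
  count≡ = cong (_∸ 2) (*-suc 2 (suc m))
  open Cover m (2 * suc (suc m) ∸ 2) (≤-reflexive count≡) s t
    s-injective (λ i → V₀⇒Even (s i) (s∈V₀ i)) t-injective (λ i → V₁⇒Odd (t i) (t∈V₁ i))
  -- For `n ≥ 2` there is at least one index; its terminal guarantees that every walk stops.
  open Paths (fromℕ< {0} (subst (0 <_) (sym count≡) (s≤s z≤n)))
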